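{- Let $A$ and $B$ be strings of lengths $m$ and $n$, respectively, over a constant-size alphabet $\Sigma$, and let $L=LCS(A,B)$. There is a data structure using $O(n)$ space that encodes the LCS score between every suffix of $B$ and every prefix of $A$ (that is, encodes the matrix $\mathcal{J}$) and supports prepending a character $\sigma\in\Sigma$ to $A$ (replacing $A$ by $\sigma A$) in $O(L)$ time. Respectively, there is a data structure using $O(m)$ space that encodes the LCS score between every suffix of $B$ and every prefix of $A$ and supports appending a character $\sigma\in\Sigma$ to $B$ (replacing $B$ by $B\sigma$) in $O(L)$ time.
   Context: $LCS(X,Y)$ is the length of a longest common subsequence of the strings $X$ and $Y$. For a string $S=\sigma_1\cdots\sigma_n$, $S[i..j]=\sigma_{i+1}\cdots\sigma_j$. The matrix $\mathcal{J}$ is indexed by $[0:n]\times[0:m]$, with $\mathcal{J}[i,j]=LCS(B[i..n],A[0..j])$. For a matrix $\mathcal{D}$ over $[0:n]\times[0:m]$, its density matrix $\mathcal{D}^\square$ is the matrix over $[1:n]\times[1:m]$ with $\mathcal{D}^\square[i,j]=\mathcal{D}[i,j]+\mathcal{D}[i-1,j-1]-\mathcal{D}[i-1,j]-\mathcal{D}[i,j-1]$; its non-zero cells are called pivotal points. The matrix $\mathcal{J}$ is encoded by storing a list of the pivotal points of $\mathcal{J}^\square$; after each update the data structure must encode the matrix $\mathcal{J}$ of the current strings. Time bounds are worst case per operation, with $L$ referring to the current strings. Each of the two data structures supports only its own single type of update. -}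

module Defs where

open import Data.Nat using (ℕ; suc; pred; _+_; _*_; _∸_; _^_; _≤_; _<_; z≤n; s≤s)
open import Data.Nat.Properties using (≤-trans; ≤-total)
open import Data.Integer as ℤ using (ℤ; +_; 0ℤ)
open import Data.Fin using (Fin; toℕ; _≟_)
open import Data.List using (List; []; _∷_; length; take; drop)
open import Data.List.Membership.Propositional using (_∈_)
open import Data.List.Relation.Unary.Unique.Propositional using (Unique)
open import Data.List.Relation.Binary.Sublist.Propositional using (_⊆_; []; _∷_; _∷ʳ_; minimum)
open import Data.List.Relation.Binary.Sublist.Propositional.Properties using (∷⁻)
open import Data.Vec as Vec using (Vec; lookup; replicate; _[_]≔_)
open import Data.Vec.Functional using (Vector; updateAt)
open import Data.Product using (Σ-syntax; ∃; ∃-syntax; _×_; _,_; proj₁; proj₂)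
open import Data.Sum using (inj₁; inj₂)
open import Data.Unit using (⊤)
open import Function using (const; _⇔_)
open import Relation.Nullary using (¬_; yes; no; contradiction)
open import Relation.Binary.PropositionalEquality using (_≡_; _≢_; refl; cong)

------------------------------------------------------------------------
-- Strings and longest common subsequences

Str : ℕ → Set
Str k = List (Fin k)

CommonSubsequence : ∀ {k} → Str k → Str k → Str k → Set
CommonSubsequence X Y Z = Z ⊆ X × Z ⊆ Y

IsLCSLength : ∀ {k} → Str k → Str k → ℕ → Set
IsLCSLength X Y ℓ =
  (∃[ Z ] CommonSubsequence X Y Z × length Z ≡ ℓ) ×
  (∀ Z → CommonSubsequence X Y Z → length Z ≤ ℓ)

longest-∷ : ∀ {k} x (X : Str k) y (Y : Str k) →
            ∃ (IsLCSLength X Y) → ∃ (IsLCSLength X (y ∷ Y)) → ∃ (IsLCSLength (x ∷ X) Y) →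
            ∃ (IsLCSLength (x ∷ X) (y ∷ Y))
longest-∷ x X y Y (ℓ , (Z , (Z⊆X , Z⊆Y) , eq) , max)
                  (a , (U , (U⊆X , U⊆Y) , eqᵃ) , maxᵃ)
                  (b , (V , (V⊆X , V⊆Y) , eqᵇ) , maxᵇ) with x ≟ y
... | yes refl =
  suc ℓ , (x ∷ Z , (refl ∷ Z⊆X , refl ∷ Z⊆Y) , cong suc eq) , λ where
    []      _       → z≤n
    (_ ∷ W) (p , q) → s≤s (max W (∷⁻ p , ∷⁻ q))
... | no x≢y with ≤-total a b
...   | inj₁ a≤b = b , (V , (V⊆X , y ∷ʳ V⊆Y) , eqᵇ) , λ where
        W (_ ∷ʳ p , q)          → ≤-trans (maxᵃ W (p , q)) a≤b
        W (p@(_ ∷ _) , _ ∷ʳ q)  → maxᵇ W (p , q)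
        W (refl ∷ _ , refl ∷ _) → contradiction refl x≢y
...   | inj₂ b≤a = a , (U , (x ∷ʳ U⊆X , U⊆Y) , eqᵃ) , λ where
        W (_ ∷ʳ p , q)          → maxᵃ W (p , q)
        W (p@(_ ∷ _) , _ ∷ʳ q)  → ≤-trans (maxᵇ W (p , q)) b≤a
        W (refl ∷ _ , refl ∷ _) → contradiction refl x≢y

longest : ∀ {k} (X Y : Str k) → ∃ (IsLCSLength X Y)
longest [] Y = 0 , ([] , ([] , minimum Y) , refl) , λ { [] _ → z≤n ; (_ ∷ _) (() , _) }
longest (x ∷ X) [] =
  0 , ([] , (minimum (x ∷ X) , []) , refl) , λ { [] _ → z≤n ; (_ ∷ _) (_ , ()) }
longest (x ∷ X) (y ∷ Y) =
  longest-∷ x X y Y (longest X Y) (longest X (y ∷ Y)) (longest (x ∷ X) Y)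

lcs : ∀ {k} → Str k → Str k → ℕ
lcs X Y = proj₁ (longest X Y)

------------------------------------------------------------------------
-- The matrix 𝒥 and its pivotal points

-- A matrix over [0:n] × [0:m]; entries outside this range are never consulted.
Matrix : Set
Matrix = ℕ → ℕ → ℤ

-- Only meaningful for indices i, j ≥ 1.
density : Matrix → Matrix
density D i j = D i j ℤ.+ D (pred i) (pred j) ℤ.- D (pred i) j ℤ.- D i (pred j)

-- B[i..n] drops the first i characters of B; A[0..j] keeps the first j of A.
𝒥 : ∀ {k} → Str k → Str k → Matrix
𝒥 A B i j = + lcs (drop i B) (take j A)

record Pivotal {k} (A B : Str k) (i j : ℕ) : Set where
  field
    1≤i     : 1 ≤ i
    i≤n     : i ≤ length B
    1≤j     : 1 ≤ j
    j≤m     : j ≤ length A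
    nonzero : density (𝒥 A B) i j ≢ 0ℤ

------------------------------------------------------------------------
-- A word RAM: r registers and S memory cells, all holding words < W.
-- Every instruction and every branch test takes one unit of time.

data Op : Set where
  add sub mul : Op

-- sub is truncated at 0.
⟦_⟧ : Op → ℕ → ℕ → ℕ
⟦ add ⟧ = _+_
⟦ sub ⟧ = _∸_
⟦ mul ⟧ = _*_

infixr 5 _⨾_

data Program (r : ℕ) : Set where
  skip                 : Program r
  _≔const_             : Fin r → ℕ → Program r
  _≔[_]_,_             : Fin r → Op → Fin r → Fin r → Program r
  _≔mem[_]             : Fin r → Fin r → Program r
  mem[_]≔_             : Fin r → Fin r → Program r
  _⨾_                  : Program r → Program r → Program r
  if_<_then_else_      : Fin r → Fin r → Program r → Program r → Program r
  while_<_loop_        : Fin r → Fin r → Program r → Program r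

Registers : ℕ → Set
Registers r = Vec ℕ r

Memory : ℕ → Set
Memory S = Vector ℕ S

-- Address a lies inside the memory and its cell contains v.
Holds : ∀ {S} → Memory S → ℕ → ℕ → Set
Holds {S} μ a v = Σ[ p ∈ Fin S ] toℕ p ≡ a × μ p ≡ v

-- Exec W P ρ μ t ρ′ μ′: started with registers ρ and memory μ, P halts after t
-- steps with registers ρ′ and memory μ′.  There is no rule for producing a word
-- ≥ W or for accessing an address ≥ S, so such runs do not halt.
data Exec (W : ℕ) {r S : ℕ} :
     Program r → Registers r → Memory S → ℕ → Registers r → Memory S → Set where

  skip : ∀ {ρ μ} → Exec W skip ρ μ 1 ρ μ

  set : ∀ {ρ μ x v} → v < W →
        Exec W (x ≔const v) ρ μ 1 (ρ [ x ]≔ v) μ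

  arith : ∀ {ρ μ x o y z} → ⟦ o ⟧ (lookup ρ y) (lookup ρ z) < W →
          Exec W (x ≔[ o ] y , z) ρ μ 1 (ρ [ x ]≔ ⟦ o ⟧ (lookup ρ y) (lookup ρ z)) μ

  load : ∀ {ρ μ x y v} → Holds μ (lookup ρ y) v →
         Exec W (x ≔mem[ y ]) ρ μ 1 (ρ [ x ]≔ v) μ

  store : ∀ {ρ μ x y} (p : Fin S) → toℕ p ≡ lookup ρ x →
          Exec W (mem[ x ]≔ y) ρ μ 1 ρ (updateAt μ p (const (lookup ρ y)))

  seq : ∀ {P Q ρ μ s ρ′ μ′ t ρ″ μ″} →
        Exec W P ρ μ s ρ′ μ′ → Exec W Q ρ′ μ′ t ρ″ μ″ →
        Exec W (P ⨾ Q) ρ μ (s + t) ρ″ μ″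

  if-true : ∀ {x y P Q ρ μ t ρ′ μ′} → lookup ρ x < lookup ρ y →
            Exec W P ρ μ t ρ′ μ′ →
            Exec W (if x < y then P else Q) ρ μ (suc t) ρ′ μ′

  if-false : ∀ {x y P Q ρ μ t ρ′ μ′} → ¬ (lookup ρ x < lookup ρ y) →
             Exec W Q ρ μ t ρ′ μ′ →
             Exec W (if x < y then P else Q) ρ μ (suc t) ρ′ μ′

  while-true : ∀ {x y P ρ μ s ρ′ μ′ t ρ″ μ″} → lookup ρ x < lookup ρ y →
               Exec W P ρ μ s ρ′ μ′ →
               Exec W (while x < y loop P) ρ′ μ′ t ρ″ μ″ →
               Exec W (while x < y loop P) ρ μ (suc (s + t)) ρ″ μ″

  while-false : ∀ {x y P ρ μ} → ¬ (lookup ρ x < lookup ρ y) →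
                Exec W (while x < y loop P) ρ μ 1 ρ μ

------------------------------------------------------------------------
-- Encoding 𝒥 in memory

-- The pairs occupy consecutive cells, starting at address a.
PairsFrom : ∀ {S} → Memory S → ℕ → List (ℕ × ℕ) → Set
PairsFrom μ a []             = ⊤
PairsFrom μ a ((i , j) ∷ ps) = Holds μ a i × Holds μ (1 + a) j × PairsFrom μ (2 + a) ps

-- Cell 0 contains the length of the list and cell 1 the address of its first entry.
StoresList : ∀ {S} → Memory S → List (ℕ × ℕ) → Set
StoresList μ ps = Holds μ 0 (length ps) × ∃[ a ] Holds μ 1 a × PairsFrom μ a ps

Encodes𝒥 : ∀ {k S} → Str k → Str k → Memory S → Set
Encodes𝒥 A B μ =
  ∃[ ps ] StoresList μ ps × Unique ps × (∀ i j → ((i , j) ∈ ps) ⇔ Pivotal A B i j)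

------------------------------------------------------------------------
-- Data structures supporting one type of update

-- The string F never changes, while G is replaced by extend σ G; the two
-- strings of the problem are stringA F G and stringB F G.
record DataStructure (k : ℕ)
                     (stringA stringB : Str k → Str k → Str k)
                     (extend : Fin k → Str k → Str k) : Set₁ where

  field
    -- The implied constants: they and the update program may depend on the
    -- alphabet size k, but not on the strings.
    spaceC timeC wordC : ℕ

  -- O(|F|) cells, which are all the memory an update may touch.
  cells : Str k → ℕ
  cells F = spaceC * suc (length F)

  -- Words of O(log (m + n)) bits.
  wordBound : Str k → Str k → ℕ
  wordBound F G = (2 + length (stringA F G) + length (stringB F G)) ^ wordC

  field
    extraRegisters : ℕ
    update         : Program (suc extraRegisters)

  -- An update starts with σ in the first register; registers do not persist
  -- from one update to the next.
  input : Fin k → Registers (suc extraRegisters)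
  input σ = toℕ σ Vec.∷ replicate extraRegisters 0

  field
    Represents : (F G : Str k) → Memory (cells F) → Set

    initial : ∀ F G → ∃[ μ ] Represents F G μ

    words : ∀ {F G μ} → Represents F G μ → ∀ p → μ p < wordBound F G

    encodes : ∀ {F G μ} → Represents F G μ → Encodes𝒥 (stringA F G) (stringB F G) μ

    update-correct : ∀ {F G μ} → Represents F G μ → ∀ σ →
      ∃[ t ] ∃[ ρ′ ] ∃[ μ′ ]
        Exec (wordBound F (extend σ G)) update (input σ) μ t ρ′ μ′ ×
        t ≤ timeC * suc (lcs (stringA F G) (stringB F G)) ×
        Represents F (extend σ G) μ′

{-# OPTIONS --safe #-}

-- Both updates reduce to one: scan a fixed string cs (B from its end, or A from
-- its start) while prepending σ to H (A, or the reverse of B).  Write score H v R for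
-- the LCS of a consumed prefix R (reversed) with the first |H| − v letters of H.
-- Consuming one more letter of cs raises score H v R by [ v < y ] for some y, the
-- pivot of that row (0 if there is none).  Prepending σ to H adds [ x ≤ v ≤ |H| ] to
-- score H v R, where x is |H| + 1 at the start; a row with letter σ takes x as its
-- pivot and passes on y, any other row takes x ⊓ y and passes on x ⊔ y.
--
-- On the list of non-zero pivots this can be done in place in time O(L): the value x
-- carried from one entry to the next is never 0, so each entry (u , y) gives exactly
-- one entry.  That entry is (u , x ⊓ y), unless σ occurs between the previous
-- entry and row u, in which case x becomes the pivot of the first such row and row u
-- loses its pivot.  A table of next occurrences, which depends only on cs, tells in
-- constant time which case applies.  Finally x may be appended to the list.
module Submission where

open import Defs
open import Data.Bool using (Bool; true; false) renaming (if_then_else_ to when_then_else_)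
open import Data.Fin as Fin using (Fin; toℕ; #_; fromℕ<; remQuot; combine)
open import Data.Fin.Properties
  using (toℕ-fromℕ<; toℕ<n; toℕ-injective; toℕ≤pred[n]; toℕ-combine; remQuot-combine)
import Data.Integer as ℤ
import Data.Integer.Properties as ℤₚ
open import Data.List
  using (List; []; _∷_; _∷ʳ_; _++_; length; take; drop; reverse; _ʳ++_; map; replicate)
open import Data.List.Properties
open import Data.List.Membership.Propositional using (_∈_)
open import Data.List.Membership.Propositional.Properties using (∈-map⁺; ∈-map⁻)
open import Data.List.Relation.Binary.Sublist.Propositional using (_⊆_)
open import Data.List.Relation.Binary.Sublist.Propositional.Properties using (reverse⁺)
open import Data.List.Relation.Unary.All as All using (All; []; _∷_)
import Data.List.Relation.Unary.All.Properties as Allₚ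
open import Data.List.Relation.Unary.AllPairs as AllPairs using (AllPairs; []; _∷_)
import Data.List.Relation.Unary.AllPairs.Properties as AllPairsₚ
open import Data.List.Relation.Unary.Any using (here; there)
open import Data.List.Relation.Unary.Unique.Propositional using (Unique)
open import Data.List.Reverse using (Reverse; []; _∶_∶ʳ_; reverseView)
open import Data.Nat
open import Data.Nat.Properties
open import Data.Product using (∃-syntax; _×_; _,_; proj₁; proj₂; swap)
open import Data.Sum using (inj₁; inj₂)
open import Data.Unit using (tt)
open import Data.Vec as Vec using (Vec; []; _∷_; lookup; _[_]≔_)
open import Data.Vec.Functional using (updateAt)
open import Data.Vec.Functional.Properties using (updateAt-updates; updateAt-minimal)
open import Function using (_∘_; const; _⇔_; mk⇔; Equivalence)
open import Relation.Nullary
open import Relation.Nullary.Decidable using (dec-true; dec-false)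
open import Relation.Binary.Definitions using (tri<; tri≈; tri>)
open import Relation.Binary.PropositionalEquality

-- Scores and pivots

IsLCSLength-unique : ∀ {k} {X Y : Str k} {ℓ ℓ′} → IsLCSLength X Y ℓ → IsLCSLength X Y ℓ′ → ℓ ≡ ℓ′
IsLCSLength-unique ((Z , Z⊆ , refl) , max) ((Z′ , Z′⊆ , refl) , max′) =
  ≤-antisym (max′ Z Z⊆) (max Z′ Z′⊆)

lcs-unique : ∀ {k} (X Y : Str k) {ℓ} → IsLCSLength X Y ℓ → lcs X Y ≡ ℓ
lcs-unique X Y = IsLCSLength-unique (proj₂ (longest X Y))

lcs-comm : ∀ {k} (X Y : Str k) → lcs X Y ≡ lcs Y X
lcs-comm X Y with longest Y X
... | ℓ , (Z , (p , q) , eq) , max = lcs-unique X Y ((Z , (q , p) , eq) , λ W r → max W (swap r))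

lcs-reverse : ∀ {k} (X Y : Str k) → lcs (reverse X) (reverse Y) ≡ lcs X Y
lcs-reverse X Y with longest X Y
... | ℓ , (Z , (p , q) , eq) , max = lcs-unique (reverse X) (reverse Y)
  ( (reverse Z , (reverse⁺ p , reverse⁺ q) , trans (length-reverse Z) eq)
  , λ W (r , s) → subst (_≤ ℓ) (length-reverse W)
      (max (reverse W) ( subst (_ ⊆_) (reverse-involutive X) (reverse⁺ r)
                       , subst (_ ⊆_) (reverse-involutive Y) (reverse⁺ s))))

lcs-[]ʳ : ∀ {k} (X : Str k) → lcs X [] ≡ 0
lcs-[]ʳ []      = refl
lcs-[]ʳ (_ ∷ _) = refl

lcs-∷-≡ : ∀ {k} (x : Fin k) X Y → lcs (x ∷ X) (x ∷ Y) ≡ suc (lcs X Y)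
lcs-∷-≡ x X Y with x Fin.≟ x
... | yes refl = refl
... | no  x≢x  = contradiction refl x≢x

lcs-∷-≢ : ∀ {k} {x y : Fin k} → x ≢ y → ∀ X Y →
          lcs (x ∷ X) (y ∷ Y) ≡ lcs X (y ∷ Y) ⊔ lcs (x ∷ X) Y
lcs-∷-≢ {x = x} {y} x≢y X Y with x Fin.≟ y
... | yes x≡y = contradiction x≡y x≢y
... | no  _   with ≤-total (lcs X (y ∷ Y)) (lcs (x ∷ X) Y)
...   | inj₁ a≤b = sym (m≤n⇒m⊔n≡n a≤b)
...   | inj₂ b≤a = sym (m≥n⇒m⊔n≡m b≤a)

δ : ℕ → ℕ → ℕ
δ v x = when does (v <? x) then 1 else 0

δ-< : ∀ {v x} → v < x → δ v x ≡ 1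
δ-< {v} {x} v<x rewrite dec-true (v <? x) v<x = refl

δ-≥ : ∀ {v x} → x ≤ v → δ v x ≡ 0
δ-≥ {v} {x} x≤v rewrite dec-false (v <? x) (≤⇒≯ x≤v) = refl

δ≤1 : ∀ v x → δ v x ≤ 1
δ≤1 v x with v <? x
... | yes v<x = ≤-reflexive (δ-< v<x)
... | no  v≮x = ≤-trans (≤-reflexive (δ-≥ (≮⇒≥ v≮x))) z≤n

δ-⊓⊔ : ∀ v x y → δ v x + δ v y ≡ δ v (x ⊓ y) + δ v (x ⊔ y)
δ-⊓⊔ v x y with ≤-total x y
... | inj₁ x≤y rewrite m≤n⇒m⊓n≡m x≤y | m≤n⇒m⊔n≡n x≤y = refl
... | inj₂ y≤x rewrite m≥n⇒m⊓n≡n y≤x | m≥n⇒m⊔n≡m y≤x = +-comm (δ v x) (δ v y)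

-- `v` counts letters cut from the end of `H`, so a value recorded for `H` refers to the same cut
-- after a letter is prepended.
score : ∀ {k} → Str k → ℕ → Str k → ℕ
score H v R = lcs R (take (length H ∸ v) H)

score-≥ : ∀ {k} (H : Str k) {v} → length H ≤ v → ∀ R → score H v R ≡ 0
score-≥ H H≤v R rewrite m≤n⇒m∸n≡0 H≤v = lcs-[]ʳ R

-- The consumed letters `R` are kept in reverse, so that consuming one more is a cons, to which the
-- LCS recursion applies.
data Fits {k} (H : Str k) : Str k → Str k → List ℕ → Set where
  []  : ∀ {R} → Fits H R [] []
  _∷_ : ∀ {R c cs y ys} → (∀ v → score H v (c ∷ R) ≡ score H v R + δ v y) →
        Fits H (c ∷ R) cs ys → Fits H R (c ∷ cs) (y ∷ ys)

bump : ∀ {k} → Fin k → ℕ → Str k → List ℕ → List ℕ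
bump σ x (c ∷ cs) (y ∷ ys) =
  when does (c Fin.≟ σ) then x ∷ bump σ y cs ys else x ⊓ y ∷ bump σ (x ⊔ y) cs ys
bump σ x _ _ = []

Fits-[] : ∀ {k} (R cs : Str k) → Fits [] R cs (replicate (length cs) 0)
Fits-[] R []       = []
Fits-[] R (c ∷ cs) = row ∷ Fits-[] (c ∷ R) cs
  where
  row : ∀ v → score [] v (c ∷ R) ≡ score [] v R + δ v 0
  row v = trans (score-≥ [] {v} z≤n (c ∷ R)) (sym (trans (+-identityʳ _) (score-≥ [] {v} z≤n R)))

module _ {k} (σ : Fin k) (H : Str k) where

  private
    H′ = σ ∷ H
    M  = suc (length H)

  score-match : ∀ R v → score H′ v (σ ∷ R) ≡ score H v R + δ v M
  score-match R v with v ≤? length H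
  ... | yes v≤H rewrite +-∸-assoc 1 v≤H | δ-< (s≤s v≤H) | +-comm (score H v R) 1 =
          lcs-∷-≡ σ R (take (length H ∸ v) H)
  ... | no v≰H with ≰⇒> v≰H
  ...   | H<v rewrite δ-≥ H<v | score-≥ H′ H<v (σ ∷ R) | score-≥ H (<⇒≤ H<v) R = refl

  score-mismatch : ∀ {c} → c ≢ σ → ∀ R v → score H′ v (c ∷ R) ≡ score H′ v R ⊔ score H v (c ∷ R)
  score-mismatch {c} c≢σ R v with v ≤? length H
  ... | yes v≤H rewrite +-∸-assoc 1 v≤H = lcs-∷-≢ c≢σ R (take (length H ∸ v) H)
  ... | no v≰H with ≰⇒> v≰H
  ...   | H<v rewrite score-≥ H′ H<v (c ∷ R) | score-≥ H′ H<v R | score-≥ H (<⇒≤ H<v) (c ∷ R) = refl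

  -- score H′ v R = score H v R + [ x ≤ v < M ], arranged so that no subtraction occurs.
  Carries : Str k → ℕ → Set
  Carries R x = ∀ v → score H′ v R + δ v x ≡ score H v R + δ v M

  -- The matching heads give the new score `score H v R + δ v M`, which `Carries` rewrites as
  -- `score H′ v R + δ v x`: the carried value becomes the pivot. The old row rose only by `δ v y`,
  -- so `y` remains to be carried.
  bump-match : ∀ {R x y} → (∀ v → score H v (σ ∷ R) ≡ score H v R + δ v y) → Carries R x →
               (∀ v → score H′ v (σ ∷ R) ≡ score H′ v R + δ v x) × Carries (σ ∷ R) y
  bump-match {R} {x} {y} row inv = (λ v → trans (score-match R v) (sym (inv v))) , λ v → begin
    score H′ v (σ ∷ R) + δ v y     ≡⟨ cong (_+ δ v y) (score-match R v) ⟩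
    score H v R + δ v M + δ v y    ≡⟨ +-assoc (score H v R) _ _ ⟩
    score H v R + (δ v M + δ v y)  ≡⟨ cong (score H v R +_) (+-comm (δ v M) _) ⟩
    score H v R + (δ v y + δ v M)  ≡⟨ +-assoc (score H v R) _ _ ⟨
    score H v R + δ v y + δ v M    ≡⟨ cong (_+ δ v M) (row v) ⟨
    score H v (σ ∷ R) + δ v M      ∎
    where open ≡-Reasoning

  -- For `v < M` the new score is the larger of `score H′ v R` and `score H v R + δ v y`. If
  -- `x ≤ v`, the former is already `score H v R + 1` and nothing is gained; if `v < x`, both start
  -- from the same score and the gain is `δ v y`. Together the gain is `δ v (x ⊓ y)`, and `δ-⊓⊔`
  -- leaves `x ⊔ y` to be carried.
  bump-mismatch : ∀ {c R x y} → c ≢ σ → x ≤ M → y ≤ M →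
                  (∀ v → score H v (c ∷ R) ≡ score H v R + δ v y) → Carries R x →
                  (∀ v → score H′ v (c ∷ R) ≡ score H′ v R + δ v (x ⊓ y)) × Carries (c ∷ R) (x ⊔ y)
  bump-mismatch {c} {R} {x} {y} c≢σ x≤M y≤M row inv = new , λ v → begin
    score H′ v (c ∷ R) + δ v (x ⊔ y)             ≡⟨ cong (_+ δ v (x ⊔ y)) (new v) ⟩
    score H′ v R + δ v (x ⊓ y) + δ v (x ⊔ y)     ≡⟨ +-assoc (score H′ v R) _ _ ⟩
    score H′ v R + (δ v (x ⊓ y) + δ v (x ⊔ y))   ≡⟨ cong (score H′ v R +_) (δ-⊓⊔ v x y) ⟨
    score H′ v R + (δ v x + δ v y)               ≡⟨ +-assoc (score H′ v R) _ _ ⟨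
    score H′ v R + δ v x + δ v y                 ≡⟨ cong (_+ δ v y) (inv v) ⟩
    score H v R + δ v M + δ v y                  ≡⟨ +-assoc (score H v R) _ _ ⟩
    score H v R + (δ v M + δ v y)                ≡⟨ cong (score H v R +_) (+-comm (δ v M) _) ⟩
    score H v R + (δ v y + δ v M)                ≡⟨ +-assoc (score H v R) _ _ ⟨
    score H v R + δ v y + δ v M                  ≡⟨ cong (_+ δ v M) (row v) ⟨
    score H v (c ∷ R) + δ v M                    ∎
    where
    open ≡-Reasoning
    join : ∀ a v → v < M → a + δ v x ≡ score H v R + 1 →
           a ⊔ (score H v R + δ v y) ≡ a + δ v (x ⊓ y)
    join a v v<M eq with v <? x
    ... | no v≮x with trans (sym (trans (cong (a +_) (δ-≥ (≮⇒≥ v≮x))) (+-identityʳ a))) eq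
    ...   | a≡ rewrite δ-≥ {v} {x ⊓ y} (≤-trans (m⊓n≤m x y) (≮⇒≥ v≮x)) | +-identityʳ a | a≡ =
            m≥n⇒m⊔n≡m (+-monoʳ-≤ (score H v R) (δ≤1 v y))
    join a v v<M eq | yes v<x with +-cancelʳ-≡ 1 a _ (trans (cong (a +_) (sym (δ-< v<x))) eq)
    ...   | refl with v <? y
    ...     | yes v<y rewrite δ-< (⊓-glb v<x v<y) | δ-< v<y = m≤n⇒m⊔n≡n (m≤m+n (score H v R) 1)
    ...     | no v≮y rewrite δ-≥ {v} {x ⊓ y} (≤-trans (m⊓n≤n x y) (≮⇒≥ v≮y)) | δ-≥ (≮⇒≥ v≮y)
              | +-identityʳ (score H v R) = ⊔-idem _
    new : ∀ v → score H′ v (c ∷ R) ≡ score H′ v R + δ v (x ⊓ y)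
    new v with v <? M
    ... | yes v<M = begin
      score H′ v (c ∷ R)                        ≡⟨ score-mismatch c≢σ R v ⟩
      score H′ v R ⊔ score H v (c ∷ R)          ≡⟨ cong (score H′ v R ⊔_) (row v) ⟩
      score H′ v R ⊔ (score H v R + δ v y)      ≡⟨ join _ v v<M (trans (inv v) (cong (score H v R +_) (δ-< v<M))) ⟩
      score H′ v R + δ v (x ⊓ y)                ∎
    ... | no v≮M with ≮⇒≥ v≮M
    -- From `M` on nothing of `H′` is left, and `x ≤ M` makes the threshold term vanish.
    ...   | M≤v rewrite score-≥ H′ M≤v (c ∷ R) | score-≥ H′ M≤v R =
              sym (δ-≥ (≤-trans (m⊓n≤m x y) (≤-trans x≤M M≤v)))

  Fits-bump : ∀ {R cs ys x} → Fits H R cs ys → All (_≤ M) ys → x ≤ M → Carries R x →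
              Fits H′ R cs (bump σ x cs ys)
  Fits-bump [] _ _ _ = []
  Fits-bump {x = x} (_∷_ {c = c} {y = y} row fits) (y≤M ∷ ys≤M) x≤M inv with c Fin.≟ σ
  ... | yes refl =
          let new , inv′ = bump-match {x = x} {y} row inv in
          new ∷ Fits-bump fits ys≤M y≤M inv′
  ... | no c≢σ =
          let new , inv′ = bump-mismatch {x = x} {y} c≢σ x≤M y≤M row inv in
          new ∷ Fits-bump fits ys≤M (⊔-lub x≤M y≤M) inv′

Carries-initial : ∀ {k} (σ : Fin k) H → Carries σ H [] (suc (length H))
Carries-initial σ H v = refl

bump-≤ : ∀ {k} (σ : Fin k) {M x} cs {ys} → x ≤ M → All (_≤ M) ys → All (_≤ M) (bump σ x cs ys)
bump-≤ σ []       x≤M _ = []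
bump-≤ σ (c ∷ cs) x≤M [] = []
bump-≤ σ (c ∷ cs) x≤M (y≤M ∷ ys≤M) with does (c Fin.≟ σ)
... | true  = x≤M ∷ bump-≤ σ cs y≤M ys≤M
... | false = ≤-trans (m⊓n≤m _ _) x≤M ∷ bump-≤ σ cs (⊔-lub x≤M y≤M) ys≤M

bump-length : ∀ {k} (σ : Fin k) x cs {ys} → length ys ≡ length cs → length (bump σ x cs ys) ≡ length cs
bump-length σ x []       {[]} eq = refl
bump-length σ x (c ∷ cs) {y ∷ ys} eq with does (c Fin.≟ σ)
... | true  = cong suc (bump-length σ y cs (suc-injective eq))
... | false = cong suc (bump-length σ (x ⊔ y) cs (suc-injective eq))

-- Sparse lists of pivots

sparse : ℕ → List ℕ → List (ℕ × ℕ)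
sparse p []           = []
sparse p (zero  ∷ ys) = sparse (suc p) ys
sparse p (suc y ∷ ys) = (suc p , suc y) ∷ sparse (suc p) ys

-- The p letters already consumed are rows 1 to p; without a further σ the result is
-- one past the last row.
next : ∀ {k} → Fin k → ℕ → Str k → ℕ
next σ p []       = suc p
next σ p (c ∷ cs) = when does (c Fin.≟ σ) then suc p else next σ (suc p) cs

nextIn : ∀ {k} → Str k → Fin k → ℕ → ℕ
nextIn cs σ p = next σ p (drop p cs)

next-> : ∀ {k} (σ : Fin k) p cs → p < next σ p cs
next-> σ p []       = ≤-refl
next-> σ p (c ∷ cs) with does (c Fin.≟ σ)
... | true  = ≤-refl
... | false = <-trans (n<1+n p) (next-> σ (suc p) cs)

next-≤ : ∀ {k} (σ : Fin k) p cs → next σ p cs ≤ suc (p + length cs)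
next-≤ σ p []       = s≤s (m≤m+n p 0)
next-≤ σ p (c ∷ cs) with does (c Fin.≟ σ)
... | true  = s≤s (m≤m+n p _)
... | false = ≤-trans (next-≤ σ (suc p) cs) (≤-reflexive (cong suc (sym (+-suc p (length cs)))))

nextIn-≤ : ∀ {k} (cs : Str k) σ {p} → p ≤ length cs → nextIn cs σ p ≤ suc (length cs)
nextIn-≤ cs σ {p} p≤n = ≤-trans (next-≤ σ p (drop p cs)) (s≤s (≤-reflexive
  (trans (cong (p +_) (length-drop p cs)) (m+[n∸m]≡n p≤n))))

outPair : (g x u y : ℕ) → ℕ × ℕ
outPair g x u y = when does (u <? g) then (u , x ⊓ y) else (g , x)

carry : (g x u y : ℕ) → ℕ
carry g x u y = when does (u <? g) then x ⊔ y else y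

-- `N` is a sentinel one past the last row: only a match before it yields the extra pair at the end.
bumpSparse : (ℕ → ℕ) → ℕ → ℕ → ℕ → List (ℕ × ℕ) → List (ℕ × ℕ)
bumpSparse g N p x []             = when does (g p <? N) then (g p , x) ∷ [] else []
bumpSparse g N p x ((u , y) ∷ ps) =
  outPair (g p) x u y ∷ bumpSparse g N u (carry (g p) x u y) ps

-- The position enters only through its next match, so rows with neither pivot nor match can be
-- skipped.
bumpSparse-cong : ∀ g N {p p′} x ps → g p ≡ g p′ → bumpSparse g N p x ps ≡ bumpSparse g N p′ x ps
bumpSparse-cong g N x []       eq rewrite eq = refl
bumpSparse-cong g N x (_ ∷ ps) eq rewrite eq = refl

-- Only the recursion of `g` along the remaining letters is recorded, so `g` stays fixed while the
-- induction shortens `cs`.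
data IsNext {k} (σ : Fin k) (g : ℕ → ℕ) (p : ℕ) : Str k → Set where
  []  : g p ≡ suc p → IsNext σ g p []
  _∷_ : ∀ {c cs} → g p ≡ (when does (c Fin.≟ σ) then suc p else g (suc p)) →
        IsNext σ g (suc p) cs → IsNext σ g p (c ∷ cs)

IsNext-> : ∀ {k σ g p} {cs : Str k} → IsNext σ g p cs → p < g p
IsNext-> ([] eq) = ≤-reflexive (sym eq)
IsNext-> {σ = σ} {g} {p} (_∷_ {c} eq nx) with does (c Fin.≟ σ)
... | true  = ≤-reflexive (sym eq)
... | false = subst (p <_) (sym eq) (<-trans (n<1+n p) (IsNext-> nx))

drop-∷ : ∀ {A : Set} p (xs : List A) {y ys} → drop p xs ≡ y ∷ ys → drop (suc p) xs ≡ ys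
drop-∷ zero    (x ∷ xs) refl = refl
drop-∷ (suc p) (x ∷ xs) eq   = drop-∷ p xs eq

nextIn-IsNext : ∀ {k} (σ : Fin k) all p cs → drop p all ≡ cs → IsNext σ (nextIn all σ) p cs
nextIn-IsNext σ all p []       eq = [] (cong (next σ p) eq)
nextIn-IsNext σ all p (c ∷ cs) eq =
  trans (cong (next σ p) eq)
    (cong (λ ds → when does (c Fin.≟ σ) then suc p else next σ (suc p) ds) (sym (drop-∷ p all eq)))
  ∷ nextIn-IsNext σ all (suc p) cs (drop-∷ p all eq)

-- A row with neither pivot nor match passes the carried value on unchanged. A match in a row
-- without a pivot stores that value and carries 0, which is the situation of `sparse-bump-0`; here
-- the carried value is always positive.
sparse-bump : ∀ {k} (σ : Fin k) {g N} p x cs ys → length ys ≡ length cs → IsNext σ g p cs →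
              N ≡ suc (p + length cs) →
              sparse p (bump σ (suc x) cs ys) ≡ bumpSparse g N p (suc x) (sparse p ys)

-- A pending match at g p absorbs the carried value, so that nothing is carried
-- until the next pivot.
sparse-bump-0 : ∀ {k} (σ : Fin k) {g N} q cs ys {p x} → length ys ≡ length cs → IsNext σ g q cs →
                N ≡ suc (q + length cs) → g p ≤ q →
                (g p , x) ∷ sparse q (bump σ 0 cs ys) ≡ bumpSparse g N p x (sparse q ys)

-- With no letters left `g p` equals `N`, so no final pair is added.
sparse-bump σ {g} {N} p x [] [] _ ([] gp) refl
  rewrite gp | dec-false (suc p <? suc (p + 0)) (≤⇒≯ (s≤s (≤-reflexive (+-identityʳ p)))) = refl
sparse-bump σ {g} {N} p x (c ∷ cs) (zero ∷ ys) len (gp ∷ nx) N≡ with c Fin.≟ σ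
... | yes _ = trans (cong (λ q → (q , suc x) ∷ _) (sym gp))
                (sparse-bump-0 σ (suc p) cs ys (suc-injective len) nx
                  (trans N≡ (cong suc (+-suc p _))) (≤-reflexive gp))
... | no  _ = trans (sparse-bump σ (suc p) x cs ys (suc-injective len) nx
                      (trans N≡ (cong suc (+-suc p _))))
                (bumpSparse-cong g N (suc x) (sparse (suc p) ys) (sym gp))
sparse-bump σ {g} {N} p x (c ∷ cs) (suc y ∷ ys) len (gp ∷ nx) N≡ with c Fin.≟ σ
-- The match is the pivot row itself, so the strict comparison fails: the carried value is stored
-- there and the old pivot passes on.
... | yes _ rewrite gp | dec-false (suc p <? suc p) (<-irrefl refl) = cong (_ ∷_)
                (sparse-bump σ (suc p) y cs ys (suc-injective len) nx
                      (trans N≡ (cong suc (+-suc p _))))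
-- The next match lies strictly beyond this row, so minimum and maximum are taken.
... | no  _ rewrite gp | dec-true (suc p <? g (suc p)) (IsNext-> nx) = cong (_ ∷_)
                (sparse-bump σ (suc p) (x ⊔ y) cs ys (suc-injective len) nx
                      (trans N≡ (cong suc (+-suc p _))))

sparse-bump-0 σ {g} {N} q [] [] {p} _ _ refl gp≤q
  rewrite dec-true (g p <? suc (q + 0)) (s≤s (≤-trans gp≤q (m≤m+n q 0))) = refl
sparse-bump-0 σ {g} {N} q (c ∷ cs) (zero ∷ ys) {p} {x} len (_ ∷ nx) N≡ gp≤q =
  trans (cong (λ zs → (g p , x) ∷ sparse q zs) lemma)
    (sparse-bump-0 σ (suc q) cs ys (suc-injective len) nx (trans N≡ (cong suc (+-suc q _))) (m≤n⇒m≤1+n gp≤q))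
  where
  -- When 0 is carried, match and mismatch have the same effect: no pivot is stored and the old
  -- value passes on.
  lemma : bump σ 0 (c ∷ cs) (zero ∷ ys) ≡ 0 ∷ bump σ 0 cs ys
  lemma with does (c Fin.≟ σ)
  ... | true  = refl
  ... | false = refl
sparse-bump-0 σ {g} {N} q (c ∷ cs) (suc y ∷ ys) {p} {x} len (_ ∷ nx) N≡ gp≤q
  -- The pending match precedes this pivot row, so the one pair due for the row is placed at `g p`
  -- and the old pivot becomes the carried value.
  rewrite dec-false (suc q <? g p) (≤⇒≯ (m≤n⇒m≤1+n gp≤q)) =
  cong ((g p , x) ∷_) (trans (cong (sparse q) lemma)
    (sparse-bump σ (suc q) y cs ys (suc-injective len) nx (trans N≡ (cong suc (+-suc q _)))))
  where
  lemma : bump σ 0 (c ∷ cs) (suc y ∷ ys) ≡ 0 ∷ bump σ (suc y) cs ys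
  lemma with does (c Fin.≟ σ)
  ... | true  = refl
  ... | false = refl

length-sparse : ∀ p ys → length (sparse p ys) ≤ length ys
length-sparse p []           = z≤n
length-sparse p (zero  ∷ ys) = m≤n⇒m≤1+n (length-sparse (suc p) ys)
length-sparse p (suc y ∷ ys) = s≤s (length-sparse (suc p) ys)

-- At `v = 0` every non-zero pivot raises the score by exactly one. Hence the list has as many
-- entries as the LCS has letters, which makes a pass over it take O(L) time.
Fits-total : ∀ {k} {H R cs : Str k} {ys} p → Fits H R cs ys →
             score H 0 (cs ʳ++ R) ≡ score H 0 R + length (sparse p ys)
Fits-total p []                     = sym (+-identityʳ _)
Fits-total p (_∷_ {y = zero}  row fits) =
  trans (Fits-total (suc p) fits) (cong (_+ _) (trans (row 0) (+-identityʳ _)))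
Fits-total {H = H} {R} p (_∷_ {y = suc y} row fits) =
  trans (Fits-total (suc p) fits) (trans (cong (_+ _) (row 0)) (+-assoc (score H 0 R) 1 _))

-- Pivots as non-zero cells of the density matrix

nth : List ℕ → ℕ → ℕ
nth []       _       = 0
nth (y ∷ ys) zero    = y
nth (y ∷ ys) (suc u) = nth ys u

Fits-nth : ∀ {k} {H R cs : Str k} {ys u} v → Fits H R cs ys → u < length cs →
           score H v (take (suc u) cs ʳ++ R) ≡ score H v (take u cs ʳ++ R) + δ v (nth ys u)
Fits-nth {u = zero}  v (row ∷ _)  _         = row v
Fits-nth {u = suc u} v (_ ∷ fits) (s≤s u<n) = Fits-nth v fits u<n

∈-sparse⁺ : ∀ p ys u {y} → nth ys u ≡ suc y → (suc (p + u) , suc y) ∈ sparse p ys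
∈-sparse⁺ p (zero  ∷ ys) (suc u) eq rewrite +-suc p u = ∈-sparse⁺ (suc p) ys u eq
∈-sparse⁺ p (suc y ∷ ys) zero    refl rewrite +-identityʳ p = here refl
∈-sparse⁺ p (suc _ ∷ ys) (suc u) eq rewrite +-suc p u = there (∈-sparse⁺ (suc p) ys u eq)

∈-sparse⁻ : ∀ p ys {w v} → (w , v) ∈ sparse p ys →
            ∃[ u ] ∃[ y ] w ≡ suc (p + u) × v ≡ suc y × u < length ys × nth ys u ≡ suc y
∈-sparse⁻ p (zero  ∷ ys) w∈ with ∈-sparse⁻ (suc p) ys w∈
... | u , y , refl , refl , u<n , eq = suc u , y , cong suc (sym (+-suc p u)) , refl , s≤s u<n , eq
∈-sparse⁻ p (suc y ∷ ys) (here refl) = 0 , y , cong suc (sym (+-identityʳ p)) , refl , s≤s z≤n , refl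
∈-sparse⁻ p (suc _ ∷ ys) (there w∈) with ∈-sparse⁻ (suc p) ys w∈
... | u , y , refl , refl , u<n , eq = suc u , y , cong suc (sym (+-suc p u)) , refl , s≤s u<n , eq

sparse-bounds : ∀ {M} p ys → All (_≤ M) ys →
                All (λ (u , v) → p < u × u ≤ p + length ys × v ≤ M) (sparse p ys)
sparse-bounds p [] [] = []
sparse-bounds p (zero ∷ ys) (_ ∷ ys≤M) rewrite +-suc p (length ys) =
  All.map (λ (p<u , bounds) → <⇒≤ p<u , bounds) (sparse-bounds (suc p) ys ys≤M)
sparse-bounds p (suc y ∷ ys) (y≤M ∷ ys≤M) rewrite +-suc p (length ys) =
  (≤-refl , s≤s (m≤m+n p _) , y≤M) ∷
  All.map (λ (p<u , bounds) → <⇒≤ p<u , bounds) (sparse-bounds (suc p) ys ys≤M)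

sparse-ascending : ∀ {M} p ys → All (_≤ M) ys →
                   AllPairs (λ (u , _) (u′ , _) → u < u′ × u′ ≤ p + length ys) (sparse p ys)
sparse-ascending p [] [] = []
sparse-ascending p (zero ∷ ys) (_ ∷ ys≤M) rewrite +-suc p (length ys) = sparse-ascending (suc p) ys ys≤M
sparse-ascending p (suc y ∷ ys) (_ ∷ ys≤M) rewrite +-suc p (length ys) =
  All.map (λ (p<u , u≤n , _) → p<u , u≤n) (sparse-bounds (suc p) ys ys≤M) ∷
  sparse-ascending (suc p) ys ys≤M

-- Row u and value v, read as a cell of the density matrix with N = |cs| + 1 and
-- M = |H| + 1: true when B is scanned from its end, false when A is from its start.
enc : Bool → ℕ → ℕ → ℕ × ℕ → ℕ × ℕ
enc true  N M (u , v) = N ∸ u , M ∸ v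
enc false N M (u , v) = v , u

-- Row numbers strictly increase along the sparse list, and one coordinate of `enc` determines them:
-- reflected at `N` or unchanged.
enc-Unique : ∀ b N {M m} ys → length ys ≤ N → All (_≤ m) ys → Unique (map (enc b N M) (sparse 0 ys))
enc-Unique b N ys len ys≤m = AllPairsₚ.map⁺ (AllPairs.map (distinct b) (sparse-ascending 0 ys ys≤m))
  where
  distinct : ∀ b {M} {p q : ℕ × ℕ} → proj₁ p < proj₁ q × proj₁ q ≤ length ys → enc b N M p ≢ enc b N M q
  distinct true  (u<u′ , u′≤n) eq =
    <⇒≢ u<u′ (∸-cancelˡ-≡ (≤-trans (<⇒≤ u<u′) (≤-trans u′≤n len)) (≤-trans u′≤n len) (cong proj₁ eq))
  distinct false (u<u′ , _) eq = <⇒≢ u<u′ (cong proj₂ eq)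

δ-step : ∀ v y → δ (suc v) y ≢ δ v y ⇔ y ≡ suc v
δ-step v y = mk⇔ to λ { refl eq → contradiction (trans (sym (δ-≥ {suc v} ≤-refl)) (trans eq (δ-< {v} ≤-refl))) λ () }
  where
  to : δ (suc v) y ≢ δ v y → y ≡ suc v
  to ≢ with <-cmp y (suc v)
  ... | tri< y<1+v _ _ = contradiction (trans (δ-≥ {suc v} (<⇒≤ y<1+v)) (sym (δ-≥ (s≤s⁻¹ y<1+v)))) ≢
  ... | tri≈ _ eq _    = eq
  ... | tri> _ _ 1+v<y = contradiction (trans (δ-< 1+v<y) (sym (δ-< (<⇒≤ 1+v<y)))) ≢

module _ {k} {H R cs : Str k} {ys} (fits : Fits H R cs ys) where

  -- Consuming the letter adds `δ v y` to each score, so the mixed difference reduces to the change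
  -- of `δ` between `v` and `suc v`, which is non-zero only at the threshold. Comparing sums avoids
  -- subtraction.
  Fits-step : ∀ {u} v → u < length cs →
    (score H (suc v) (take (suc u) cs ʳ++ R) + score H v (take u cs ʳ++ R) ≢
     score H v (take (suc u) cs ʳ++ R) + score H (suc v) (take u cs ʳ++ R)) ⇔ nth ys u ≡ suc v
  Fits-step {u} v u<n = mk⇔
    (λ ≢ → Equivalence.to (δ-step v (nth ys u)) λ eq → ≢ (Equivalence.from same eq))
    (λ eq → Equivalence.from (δ-step v (nth ys u)) eq ∘ Equivalence.to same)
    where
    a = score H (suc v) (take u cs ʳ++ R)
    b = score H v (take u cs ʳ++ R)
    y = nth ys u
    L≡ : score H (suc v) (take (suc u) cs ʳ++ R) + b ≡ a + b + δ (suc v) y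
    L≡ = trans (cong (_+ b) (Fits-nth (suc v) fits u<n))
           (trans (+-assoc a _ b) (trans (cong (a +_) (+-comm (δ (suc v) y) b)) (sym (+-assoc a b _))))
    R≡ : score H v (take (suc u) cs ʳ++ R) + a ≡ a + b + δ v y
    R≡ = trans (+-comm _ a) (trans (cong (a +_) (Fits-nth v fits u<n)) (sym (+-assoc a b _)))
    same : (score H (suc v) (take (suc u) cs ʳ++ R) + b ≡ score H v (take (suc u) cs ʳ++ R) + a) ⇔ 
           (δ (suc v) y ≡ δ v y)
    same = mk⇔ (λ eq → +-cancelˡ-≡ (a + b) _ _ (trans (sym L≡) (trans eq R≡)))
               (λ eq → trans L≡ (trans (cong (a + b +_) eq) (sym R≡)))

density-≢0 : ∀ D i j {a b c d} → D i j ≡ ℤ.+ a → D (pred i) (pred j) ≡ ℤ.+ b →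
             D (pred i) j ≡ ℤ.+ c → D i (pred j) ≡ ℤ.+ d →
             density D i j ≢ ℤ.0ℤ ⇔ a + b ≢ c + d
density-≢0 D i j {a} {b} {c} {d} eqᵃ eqᵇ eqᶜ eqᵈ = mk⇔
  (λ ≢ eq → ≢ (trans regroup (ℤₚ.i≡j⇒i-j≡0 (cong ℤ.+_ eq))))
  (λ ≢ eq → ≢ (ℤₚ.+-injective (ℤₚ.i-j≡0⇒i≡j _ _ (trans (sym regroup) eq))))
  where
  regroup : density D i j ≡ ℤ.+ (a + b) ℤ.- ℤ.+ (c + d)
  regroup rewrite eqᵃ | eqᵇ | eqᶜ | eqᵈ = trans
    (ℤₚ.+-assoc (ℤ.+ (a + b)) (ℤ.- (ℤ.+ c)) _)
    (cong (λ z → ℤ.+ (a + b) ℤ.+ z) (sym (ℤₚ.neg-distrib-+ (ℤ.+ c) (ℤ.+ d))))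

pairs : Bool → ℕ → ℕ → List ℕ → List (ℕ × ℕ)
pairs b n m ys = map (enc b (suc n) (suc m)) (sparse 0 ys)

take-length-++ : ∀ {A : Set} (xs {ys} : List A) → take (length xs) (xs ++ ys) ≡ xs
take-length-++ []       = refl
take-length-++ (x ∷ xs) = cong (x ∷_) (take-length-++ xs)

reverse-drop : ∀ {A : Set} i (xs : List A) → reverse (drop i xs) ≡ take (length xs ∸ i) (reverse xs)
reverse-drop i xs = sym (begin
  take (length xs ∸ i) (reverse xs)
    ≡⟨ cong (λ n → take n (reverse xs)) (trans (sym (length-drop i xs)) (sym (length-reverse (drop i xs)))) ⟩
  take (length (reverse (drop i xs))) (reverse xs)
    ≡⟨ cong (take _) (trans (cong reverse (sym (take++drop≡id i xs))) (reverse-++ (take i xs) (drop i xs))) ⟩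
  take (length (reverse (drop i xs))) (reverse (drop i xs) ++ reverse (take i xs))
    ≡⟨ take-length-++ (reverse (drop i xs)) ⟩
  reverse (drop i xs) ∎)
  where open ≡-Reasoning

-- A suffix of `B` is a prefix of `reverse B`, turned back by `ʳ++ []`; keeping `j` letters of `A`
-- means cutting `length A ∸ j`.
𝒥-suffix : ∀ {k} (A B : Str k) i {j} → j ≤ length A →
           𝒥 A B i j ≡ ℤ.+ score A (length A ∸ j) (take (length B ∸ i) (reverse B) ʳ++ [])
𝒥-suffix A B i j≤m = cong ℤ.+_ (cong₂ lcs
  (trans (sym (reverse-involutive (drop i B))) (cong reverse (reverse-drop i B)))
  (cong (λ n → take n A) (sym (m∸[m∸n]≡n j≤m))))

-- Reversing both strings preserves the LCS and turns dropping `i` letters of `B` into cutting `i`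
-- letters from the end of `reverse B`, so `v` is `i` itself.
𝒥-prefix : ∀ {k} (A B : Str k) i j → 𝒥 A B i j ≡ ℤ.+ score (reverse B) i (take j A ʳ++ [])
𝒥-prefix A B i j = cong ℤ.+_ (trans (sym (lcs-reverse (drop i B) (take j A)))
  (trans (lcs-comm (reverse (drop i B)) _)
    (cong (lcs (reverse (take j A)))
      (trans (reverse-drop i B) (cong (λ n → take (n ∸ i) (reverse B)) (sym (length-reverse B)))))))

pairs-prefix : ∀ {k} (A B : Str k) {ys} → Fits (reverse B) [] A ys → length ys ≡ length A → All (_≤ length B) ys →
               ∀ i j → (i , j) ∈ pairs false (length A) (length B) ys ⇔ Pivotal A B i j
pairs-prefix A B {ys} fits len ys≤m i j = mk⇔ to from
  where
  nonzero⇔ : ∀ {u} v → u < length A → density (𝒥 A B) (suc v) (suc u) ≢ ℤ.0ℤ ⇔ nth ys u ≡ suc v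
  nonzero⇔ {u} v u<n =
    let D≢0 = density-≢0 (𝒥 A B) (suc v) (suc u)
                  (𝒥-prefix A B (suc v) (suc u)) (𝒥-prefix A B v u)
                  (𝒥-prefix A B v (suc u)) (𝒥-prefix A B (suc v) u)
        ⇔nth = Fits-step fits v u<n
    in mk⇔ (Equivalence.to ⇔nth ∘ Equivalence.to D≢0) (Equivalence.from D≢0 ∘ Equivalence.from ⇔nth)
  to : (i , j) ∈ pairs false (length A) (length B) ys → Pivotal A B i j
  to ij∈ with ∈-map⁻ (enc false (suc (length A)) (suc (length B))) ij∈
  ... | (w , v) , wv∈ , refl with All.lookup (sparse-bounds 0 ys ys≤m) wv∈ | ∈-sparse⁻ 0 ys wv∈
  ...   | 0<w , w≤n , v≤m | u , y , refl , refl , u<n , eq = record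
    { 1≤i = s≤s z≤n ; i≤n = v≤m ; 1≤j = 0<w ; j≤m = subst (_ ≤_) len w≤n
    ; nonzero = Equivalence.from (nonzero⇔ y (subst (u <_) len u<n)) eq }
  from : Pivotal A B i j → (i , j) ∈ pairs false (length A) (length B) ys
  from record { 1≤i = s≤s {n = v} z≤n ; 1≤j = s≤s {n = u} z≤n ; j≤m = j≤m ; nonzero = nonzero } =
    ∈-map⁺ (enc false (suc (length A)) (suc (length B))) (∈-sparse⁺ 0 ys u (Equivalence.to (nonzero⇔ v j≤m) nonzero))

pairs-suffix : ∀ {k} (A B : Str k) {ys} → Fits A [] (reverse B) ys → length ys ≡ length B → All (_≤ length A) ys →
               ∀ i j → (i , j) ∈ pairs true (length B) (length A) ys ⇔ Pivotal A B i j
pairs-suffix A B {ys} fits len ys≤m i j = mk⇔ to from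
  where
  n = length B
  m = length A
  nonzero⇔ : ∀ {i j} → i < n → j < m →
             density (𝒥 A B) (suc i) (suc j) ≢ ℤ.0ℤ ⇔ nth ys (n ∸ suc i) ≡ m ∸ j
  nonzero⇔ {i} {j} i<n j<m =
    subst (λ v → density (𝒥 A B) (suc i) (suc j) ≢ ℤ.0ℤ ⇔ nth ys (n ∸ suc i) ≡ v) (sym m∸j≡)
      (mk⇔ (λ D≢ → Equivalence.to ⇔nth λ eq → Equivalence.to D≢0 D≢ (trans (sym comm) eq))
           (λ nth≡ → Equivalence.from D≢0 λ eq → Equivalence.from ⇔nth nth≡ (trans comm eq)))
    where
    m∸j≡ : m ∸ j ≡ suc (m ∸ suc j)
    m∸j≡ = +-∸-assoc 1 j<m
    n∸i≡ : n ∸ i ≡ suc (n ∸ suc i)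
    n∸i≡ = +-∸-assoc 1 i<n
    U : ℕ → Str _
    U u = take u (reverse B) ʳ++ []
    -- Both indices run backwards here, so the two diagonal summands of the density appear in the
    -- opposite order.
    comm = +-comm (score A (suc (m ∸ suc j)) (U (suc (n ∸ suc i)))) (score A (m ∸ suc j) (U (n ∸ suc i)))
    D≢0 = density-≢0 (𝒥 A B) (suc i) (suc j)
      (𝒥-suffix A B (suc i) j<m)
      (trans (𝒥-suffix A B i (<⇒≤ j<m)) (cong₂ (λ u v → ℤ.+ score A v (U u)) n∸i≡ m∸j≡))
      (trans (𝒥-suffix A B i j<m) (cong (λ u → ℤ.+ score A (m ∸ suc j) (U u)) n∸i≡))
      (trans (𝒥-suffix A B (suc i) (<⇒≤ j<m)) (cong (λ v → ℤ.+ score A v (U (n ∸ suc i))) m∸j≡))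
    ⇔nth = Fits-step fits {n ∸ suc i} (m ∸ suc j)
      (subst (n ∸ suc i <_) (sym (length-reverse B)) (subst (_≤ n) n∸i≡ (m∸n≤m n i)))
  to : (i , j) ∈ pairs true n m ys → Pivotal A B i j
  to ij∈ with ∈-map⁻ (enc true (suc n) (suc m)) ij∈
  ... | (w , v) , wv∈ , refl with All.lookup (sparse-bounds 0 ys ys≤m) wv∈ | ∈-sparse⁻ 0 ys wv∈
  ...   | 0<w , w≤n , v≤m | u , y , refl , refl , u<n′ , eq with subst (u <_) len u<n′
  -- Row `suc u` and value `suc y` denote the cell `(n ∸ u , m ∸ y)`; the rewrite exposes both
  -- coordinates as successors.
  ...     | u<n rewrite +-∸-assoc 1 u<n | +-∸-assoc 1 v≤m = record
    { 1≤i = s≤s z≤n ; i≤n = n∸u≤ ; 1≤j = s≤s z≤n ; j≤m = m∸y≤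
    ; nonzero = Equivalence.from (nonzero⇔ n∸u≤ m∸y≤)
        (trans (cong (nth ys) (suc-injective (trans (sym (+-∸-assoc 1 n∸u≤)) (m∸[m∸n]≡n u<n))))
          (trans eq (sym (m∸[m∸n]≡n v≤m)))) }
    where
    n∸u≤ : suc (n ∸ suc u) ≤ n
    n∸u≤ = subst (_≤ n) (+-∸-assoc 1 u<n) (m∸n≤m n u)
    m∸y≤ : suc (m ∸ suc y) ≤ m
    m∸y≤ = subst (_≤ m) (+-∸-assoc 1 v≤m) (m∸n≤m m y)
  from : Pivotal A B i j → (i , j) ∈ pairs true n m ys
  from record { 1≤i = s≤s {n = i′} z≤n ; i≤n = i≤n ; 1≤j = s≤s {n = j′} z≤n ; j≤m = j≤m ; nonzero = nonzero } =
    subst (_∈ pairs true n m ys) (cong₂ _,_ (m∸[m∸n]≡n i≤n) (m∸[m∸n]≡n j≤m))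
      (∈-map⁺ (enc true (suc n) (suc m)) (∈-sparse⁺ 0 ys (n ∸ suc i′) (trans (Equivalence.to (nonzero⇔ i≤n j≤m) nonzero) (+-∸-assoc 1 j≤m))))

-- Running times and memory

-- Bounds the running time of programs without loops.
cost : ∀ {r} → Program r → ℕ
cost (P ⨾ Q)                    = cost P + cost Q
cost (if x < y then P else Q)   = suc (cost P ⊔ cost Q)
cost _                          = 1

-- The postcondition may itself be a `Run` of the remaining program, so proofs follow the program
-- text; time is compared with the static `cost` rather than counted.
record Run (W : ℕ) {r S} (P : Program r) (ρ : Registers r) (μ : Memory S)
           (Post : Registers r → Memory S → Set) : Set where
  constructor run
  field
    {time}  : ℕ
    {ρ′}    : Registers r
    {μ′}    : Memory S
    exec    : Exec W P ρ μ time ρ′ μ′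
    time≤   : time ≤ cost P
    post    : Post ρ′ μ′

module _ {W r S : ℕ} {ρ : Registers r} {μ : Memory S} {Post : Registers r → Memory S → Set} where

  skip! : Post ρ μ → Run W skip ρ μ Post
  skip! = run skip ≤-refl

  seq! : ∀ {P Q} → Run W P ρ μ (λ ρ′ μ′ → Run W Q ρ′ μ′ Post) → Run W (P ⨾ Q) ρ μ Post
  seq! (run e t≤ (run e′ t′≤ post)) = run (seq e e′) (+-mono-≤ t≤ t′≤) post

  set! : ∀ {x v Q} → v < W → Run W Q (ρ [ x ]≔ v) μ Post → Run W ((x ≔const v) ⨾ Q) ρ μ Post
  set! v<W (run e t≤ post) = run (seq (set v<W) e) (s≤s t≤) post

  arith! : ∀ {x o y z Q} → ⟦ o ⟧ (lookup ρ y) (lookup ρ z) < W →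
           Run W Q (ρ [ x ]≔ ⟦ o ⟧ (lookup ρ y) (lookup ρ z)) μ Post →
           Run W ((x ≔[ o ] y , z) ⨾ Q) ρ μ Post
  arith! v<W (run e t≤ post) = run (seq (arith v<W) e) (s≤s t≤) post

  load! : ∀ {x y v Q} → Holds μ (lookup ρ y) v →
          Run W Q (ρ [ x ]≔ v) μ Post → Run W ((x ≔mem[ y ]) ⨾ Q) ρ μ Post
  load! h (run e t≤ post) = run (seq (load h) e) (s≤s t≤) post

  store! : ∀ {x y Q} (p : Fin S) → toℕ p ≡ lookup ρ x →
           Run W Q ρ (updateAt μ p (const (lookup ρ y))) Post → Run W ((mem[ x ]≔ y) ⨾ Q) ρ μ Post
  store! p p≡ (run e t≤ post) = run (seq (store p p≡) e) (s≤s t≤) post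

  if-true! : ∀ {x y P Q} → lookup ρ x < lookup ρ y → Run W P ρ μ Post →
             Run W (if x < y then P else Q) ρ μ Post
  if-true! {Q = Q} x<y (run e t≤ post) =
    run (if-true x<y e) (s≤s (≤-trans t≤ (m≤m⊔n _ (cost Q)))) post

  if-false! : ∀ {x y P Q} → ¬ (lookup ρ x < lookup ρ y) → Run W Q ρ μ Post →
              Run W (if x < y then P else Q) ρ μ Post
  if-false! {P = P} x≮y (run e t≤ post) =
    run (if-false x≮y e) (s≤s (≤-trans t≤ (m≤n⊔m (cost P) _))) post

-- Memory

Bounded : ∀ {S} → ℕ → Memory S → Set
Bounded W μ = ∀ p → μ p < W

Holds-< : ∀ {S} {μ : Memory S} {a v} → Holds μ a v → a < S
Holds-< (p , refl , _) = toℕ<n p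

module _ {S} (μ : Memory S) (p : Fin S) (w : ℕ) where

  write : Memory S
  write = updateAt μ p (const w)

  write-here : ∀ {a} → toℕ p ≡ a → Holds write a w
  write-here p≡a = p , p≡a , updateAt-updates p μ

  write-there : ∀ {a v} → a ≢ toℕ p → Holds μ a v → Holds write a v
  write-there a≢p (q , refl , eq) = q , refl , trans (updateAt-minimal q p μ (a≢p ∘ cong toℕ)) eq

  write-Bounded : ∀ {W} → w < W → Bounded W μ → Bounded W write
  write-Bounded {W} w<W bounded q with q Fin.≟ p
  ... | yes refl = subst (_< W) (sym (updateAt-updates p μ)) w<W
  ... | no  q≢p  = subst (_< W) (sym (updateAt-minimal q p μ q≢p)) (bounded q)

PairsFrom-resp : ∀ {S} {μ μ′ : Memory S} {a} ps →
                 (∀ {b v} → a ≤ b → b < length ps * 2 + a → Holds μ b v → Holds μ′ b v) →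
                 PairsFrom μ a ps → PairsFrom μ′ a ps
PairsFrom-resp [] _ _ = tt
PairsFrom-resp {a = a} (_ ∷ ps) keep (h , h′ , hs) =
  keep ≤-refl (s≤s (m≤n⇒m≤1+n (m≤n+m a _))) h ,
  keep (n≤1+n a) (s≤s (s≤s (m≤n+m a _))) h′ ,
  PairsFrom-resp ps (λ {b} 2+a≤b b< → keep (≤-trans (m≤n+m a 2) 2+a≤b)
    (subst (b <_) (trans (+-suc _ (suc a)) (cong suc (+-suc _ a))) b<)) hs

PairsFrom-++ : ∀ {S} {μ : Memory S} {a} ps {qs} → PairsFrom μ a ps → PairsFrom μ (length ps * 2 + a) qs →
               PairsFrom μ a (ps ++ qs)
PairsFrom-++ [] _ hs′ = hs′
PairsFrom-++ {μ = μ} {a} (_ ∷ ps) {qs} (h , h′ , hs) hs′ =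
  h , h′ , PairsFrom-++ ps hs
    (subst (λ b → PairsFrom μ b qs) (sym (trans (+-suc _ (suc a)) (cong suc (+-suc _ a)))) hs′)

-- The update program

rσ rzero rone rptr rend rp rx rN rM rM′ rtb ru ry rg rou rov rq : Fin 17
rσ = # 0
rzero = # 1
rone = # 2
rptr = # 3
rend = # 4
rp = # 5
rx = # 6
rN = # 7
rM = # 8
rM′ = # 9
rtb = # 10
ru = # 11
ry = # 12
rg = # 13
rou = # 14
rov = # 15
rq = # 16

-- p is the last key read (so the number of consumed letters), x the carried value and
-- tb the address of the table row of the new letter.
state : (s ptr end p x N M tb : ℕ) → Vec ℕ 6 → Registers 17
state s ptr end p x N M tb scr =
  s ∷ 0 ∷ 1 ∷ ptr ∷ end ∷ p ∷ x ∷ N ∷ M ∷ suc M ∷ tb ∷ scr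

-- With `true`, reading undoes the reflection at the old height `M`, whereas writing reflects at
-- `M′ = M + 1`, since a letter prepended to A shifts all columns by one. With `false` the
-- coordinates are merely swapped.
fetch put body finish update : Bool → Program 17
select setup : Program 17

fetch true  = ru ≔mem[ rptr ] ⨾ ru ≔[ sub ] rN , ru ⨾
              rq ≔[ add ] rone , rptr ⨾ ry ≔mem[ rq ] ⨾ ry ≔[ sub ] rM , ry ⨾ skip
fetch false = ry ≔mem[ rptr ] ⨾ rq ≔[ add ] rone , rptr ⨾ ru ≔mem[ rq ] ⨾ skip

put true  = rou ≔[ sub ] rN , rou ⨾ rov ≔[ sub ] rM′ , rov ⨾
            mem[ rptr ]≔ rou ⨾ rq ≔[ add ] rone , rptr ⨾ mem[ rq ]≔ rov ⨾ skip
put false = mem[ rptr ]≔ rov ⨾ rq ≔[ add ] rone , rptr ⨾ mem[ rq ]≔ rou ⨾ skip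

select =
  if ru < rg
  then rou ≔[ add ] rzero , ru ⨾
       (if rx < ry
        then rov ≔[ add ] rzero , rx ⨾ rx ≔[ add ] rzero , ry ⨾ skip
        else (rov ≔[ add ] rzero , ry ⨾ skip))
  else (rou ≔[ add ] rzero , rg ⨾ rov ≔[ add ] rzero , rx ⨾ rx ≔[ add ] rzero , ry ⨾ skip)

body b =
  fetch b ⨾ rg ≔[ add ] rtb , rp ⨾ rg ≔mem[ rg ] ⨾ select ⨾ rp ≔[ add ] rzero , ru ⨾
  put b ⨾ rptr ≔[ add ] rone , rptr ⨾ rptr ≔[ add ] rone , rptr ⨾ skip

-- All registers but `rσ` start at 0, so `rzero` and `rp` are right already. The carried value
-- starts as `M`, the old length plus one, and the table begins at address 4.
setup =
  rone ≔const 1 ⨾ rq ≔const 2 ⨾ rN ≔mem[ rq ] ⨾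
  rend ≔mem[ rzero ] ⨾ rend ≔[ mul ] rend , rq ⨾ rptr ≔mem[ rone ] ⨾ rend ≔[ add ] rend , rptr ⨾
  rq ≔[ add ] rone , rq ⨾ rM ≔mem[ rq ] ⨾ rM′ ≔[ add ] rone , rM ⨾ mem[ rq ]≔ rM′ ⨾
  rx ≔[ add ] rzero , rM ⨾
  rtb ≔[ mul ] rσ , rN ⨾ rq ≔[ add ] rone , rq ⨾ rtb ≔[ add ] rq , rtb ⨾ skip

finish b =
  rg ≔[ add ] rtb , rp ⨾ rg ≔mem[ rg ] ⨾
  (if rg < rN
   then rou ≔[ add ] rzero , rg ⨾ rov ≔[ add ] rzero , rx ⨾ put b ⨾
        rg ≔mem[ rzero ] ⨾ rg ≔[ add ] rone , rg ⨾ mem[ rzero ]≔ rg ⨾ skip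
   else skip)

update b = setup ⨾ (while rptr < rend loop body b) ⨾ finish b

-- Correctness of the parts of the update program

writePair : ∀ {S} → Memory S → Fin S → Fin S → ℕ × ℕ → Memory S
writePair μ p₀ p₁ (c , d) = write (write μ p₀ c) p₁ d

module _ {S} (μ : Memory S) {p₀ p₁ : Fin S} {a} (p₀≡ : toℕ p₀ ≡ a) (p₁≡ : toℕ p₁ ≡ suc a) (cd : ℕ × ℕ) where

  writePair-here : Holds (writePair μ p₀ p₁ cd) a (proj₁ cd) ×
                   Holds (writePair μ p₀ p₁ cd) (suc a) (proj₂ cd)
  writePair-here =
    write-there _ p₁ _ (λ eq → <⇒≢ (n<1+n a) (trans eq p₁≡)) (write-here μ p₀ _ p₀≡) ,
    write-here _ p₁ _ p₁≡

  writePair-there : ∀ {b v} → b ≢ a → b ≢ suc a → Holds μ b v → Holds (writePair μ p₀ p₁ cd) b v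
  writePair-there b≢a b≢1+a h =
    write-there _ p₁ _ (λ eq → b≢1+a (trans eq p₁≡)) (write-there μ p₀ _ (λ eq → b≢a (trans eq p₀≡)) h)

  writePair-below : ∀ {b v} → b < a → Holds μ b v → Holds (writePair μ p₀ p₁ cd) b v
  writePair-below b<a = writePair-there (<⇒≢ b<a) (<⇒≢ (m<n⇒m<1+n b<a))

  writePair-above : ∀ {b v} → suc a < b → Holds μ b v → Holds (writePair μ p₀ p₁ cd) b v
  writePair-above 1+a<b = writePair-there (>⇒≢ (<⇒≤ 1+a<b)) (>⇒≢ 1+a<b)

  writePair-Bounded : ∀ {W} → proj₁ cd < W → proj₂ cd < W → Bounded W μ → Bounded W (writePair μ p₀ p₁ cd)
  writePair-Bounded c<W d<W bounded = write-Bounded _ p₁ _ d<W (write-Bounded μ p₀ _ c<W bounded)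

enc-< : ∀ b {N M W u v} → N < W → M < W → u ≤ N → v ≤ M →
        proj₁ (enc b N M (u , v)) < W × proj₂ (enc b N M (u , v)) < W
enc-< true  {N} {M} {u = u} {v} N<W M<W u≤N v≤M = ≤-<-trans (m∸n≤m N u) N<W , ≤-<-trans (m∸n≤m M v) M<W
enc-< false N<W M<W u≤N v≤M = ≤-<-trans v≤M M<W , ≤-<-trans u≤N N<W

module _ {W S : ℕ} {s ptr end p N M tb : ℕ} {μ : Memory S} {Post : Registers 17 → Memory S → Set}
         (N<W : N < W) (M<W : suc M < W) (ptr<W : suc ptr < W) where

  fetch-run : ∀ b {x u y scr} → u ≤ N → y ≤ M →
              Holds μ ptr (proj₁ (enc b N M (u , y))) → Holds μ (suc ptr) (proj₂ (enc b N M (u , y))) →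
              (∀ scr′ → Post (state s ptr end p x N M tb (u ∷ y ∷ scr′)) μ) →
              Run W (fetch b) (state s ptr end p x N M tb scr) μ Post
  fetch-run true {x} {u} {y} {_ ∷ _ ∷ g ∷ ou ∷ ov ∷ _ ∷ []} u≤N y≤M h h′ post =
    load! h (arith! (≤-<-trans (m∸n≤m N (N ∸ u)) N<W) (arith! ptr<W (load! h′
      (arith! (≤-<-trans (m∸n≤m M (M ∸ y)) (<⇒≤ M<W)) (skip!
        (subst₂ (λ u y → Post (state s ptr end p x N M tb (u ∷ y ∷ g ∷ ou ∷ ov ∷ suc ptr ∷ [])) μ)
          (sym (m∸[m∸n]≡n u≤N)) (sym (m∸[m∸n]≡n y≤M)) (post _)))))))
  fetch-run false {scr = _ ∷ _ ∷ _ ∷ _ ∷ _ ∷ _ ∷ []} u≤N y≤M h h′ post =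
    load! h (arith! ptr<W (load! h′ (skip! (post _))))

  put-run : ∀ b {x u y g ou ov q} {p₀ p₁ : Fin S} → toℕ p₀ ≡ ptr → toℕ p₁ ≡ suc ptr →
            (∀ scr → Post (state s ptr end p x N M tb scr) (writePair μ p₀ p₁ (enc b N (suc M) (ou , ov)))) →
            Run W (put b) (state s ptr end p x N M tb (u ∷ y ∷ g ∷ ou ∷ ov ∷ q ∷ [])) μ Post
  put-run true  {ou = ou} {ov} p₀≡ p₁≡ post =
    arith! (≤-<-trans (m∸n≤m N ou) N<W) (arith! (≤-<-trans (m∸n≤m (suc M) ov) M<W)
      (store! _ p₀≡ (arith! ptr<W (store! _ p₁≡ (skip! (post _))))))
  put-run false p₀≡ p₁≡ post =
    store! _ p₀≡ (arith! ptr<W (store! _ p₁≡ (skip! (post _))))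

  select-run : ∀ {x u y g ou ov q} → u < W → g < W → x < W → y < W →
               Post (state s ptr end p (carry g x u y) N M tb
                      (u ∷ y ∷ g ∷ proj₁ (outPair g x u y) ∷ proj₂ (outPair g x u y) ∷ q ∷ [])) μ →
               Run W select (state s ptr end p x N M tb (u ∷ y ∷ g ∷ ou ∷ ov ∷ q ∷ [])) μ Post
  select-run {x} {u} {y} {g} u<W g<W x<W y<W post with u <? g
  ... | no u≮g rewrite dec-false (u <? g) u≮g =
    if-false! u≮g (arith! g<W (arith! x<W (arith! y<W (skip! post))))
  ... | yes u<g rewrite dec-true (u <? g) u<g with x <? y
  ...   | yes x<y rewrite m≤n⇒m⊓n≡m (<⇒≤ x<y) | m≤n⇒m⊔n≡n (<⇒≤ x<y) =
    if-true! u<g (arith! u<W (if-true! x<y (arith! x<W (arith! y<W (skip! post)))))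
  ...   | no x≮y rewrite m≥n⇒m⊓n≡n (≮⇒≥ x≮y) | m≥n⇒m⊔n≡m (≮⇒≥ x≮y) =
    if-true! u<g (arith! u<W (if-false! x≮y (arith! y<W (skip! post))))

outPair-≤ : ∀ {g x u y n M} → u ≤ n → g ≤ suc n → x ≤ M →
            proj₁ (outPair g x u y) ≤ suc n × proj₂ (outPair g x u y) ≤ M
outPair-≤ {g} {x} {u} {y} u≤n g≤N x≤M with u <? g
... | yes u<g rewrite dec-true (u <? g) u<g = m≤n⇒m≤1+n u≤n , ≤-trans (m⊓n≤m x y) x≤M
... | no  u≮g rewrite dec-false (u <? g) u≮g = g≤N , x≤M

carry-≤ : ∀ {g x u y M} → x ≤ M → y ≤ M → carry g x u y ≤ M
carry-≤ {g} {x} {u} {y} x≤M y≤M with u <? g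
... | yes u<g rewrite dec-true (u <? g) u<g = ⊔-lub x≤M y≤M
... | no  u≮g rewrite dec-false (u <? g) u≮g = y≤M

module _ {W S : ℕ} (b : Bool) (n M s tb end : ℕ) (g : ℕ → ℕ)
         (N<W : suc n < W) (M<W : suc M < W) (S<W : S < W)
         (g≤N : ∀ {p} → p ≤ n → g p ≤ suc n) where

  private
    N  = suc n
    st = λ ptr p x → state s ptr end p x N M tb

  Table : Memory S → Set
  Table μ = ∀ {p} → p ≤ n → Holds μ (tb + p) (g p)

  record Looped (a p x : ℕ) (ps : List (ℕ × ℕ)) (scr : Vec ℕ 6) (μ : Memory S) : Set where
    field
      {time} : ℕ
      {p′ x′} : ℕ
      {scr′} : Vec ℕ 6
      {μ′}   : Memory S
      {qs}   : List (ℕ × ℕ)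
      exec   : Exec W (while rptr < rend loop body b) (st a p x scr) μ time (st end p′ x′ scr′) μ′
      time≤  : time ≤ suc (length ps * suc (cost (body b)))
      p′≤n   : p′ ≤ n
      x′≤M   : x′ ≤ M
      -- The written pairs `qs` are the whole result except for the optional last pair, which is
      -- left to `finish`.
      output : bumpSparse g N p x ps ≡ qs ++ bumpSparse g N p′ x′ []
      length≡ : length qs ≡ length ps
      stored : PairsFrom μ′ a (map (enc b N (suc M)) qs)
      below  : ∀ {c v} → c < a → Holds μ c v → Holds μ′ c v
      bounded : Bounded W μ′

  body-run : ∀ {a p x u y scr} {μ : Memory S} → p ≤ n → x ≤ M → u ≤ n → y ≤ M →
             Table μ →
             (h : Holds μ a (proj₁ (enc b N M (u , y)))) (h′ : Holds μ (suc a) (proj₂ (enc b N M (u , y)))) →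
             Run W (body b) (st a p x scr) μ λ ρ′ μ′ →
               (∃[ scr′ ] ρ′ ≡ st (2 + a) u (carry (g p) x u y) scr′) ×
               μ′ ≡ writePair μ (proj₁ h) (proj₁ h′) (enc b N (suc M) (outPair (g p) x u y))
  body-run {a} {p} {x} {u} {y} {scr} {μ} p≤n x≤M u≤n y≤M table h h′ =
    seq! (fetch-run N<W M<W 1+a<W b (m≤n⇒m≤1+n u≤n) y≤M h h′ λ where
      (_ ∷ _ ∷ _ ∷ _ ∷ []) →
        arith! (<-trans (Holds-< (table p≤n)) S<W) (load! (table p≤n)
        (seq! (select-run N<W M<W 1+a<W (<-trans (s≤s u≤n) N<W) (≤-<-trans (g≤N p≤n) N<W)
                 (≤-<-trans x≤M (<⇒≤ M<W)) (≤-<-trans y≤M (<⇒≤ M<W))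
        (arith! (<-trans (s≤s u≤n) N<W)
        (seq! (put-run N<W M<W 1+a<W b {p₀ = proj₁ h} {proj₁ h′} (proj₁ (proj₂ h)) (proj₁ (proj₂ h′)) λ scr′ →
        arith! 1+a<W (arith! (≤-<-trans (Holds-< h′) S<W) (skip! ((scr′ , refl) , refl))))))))))
    where
    1+a<W : suc a < W
    1+a<W = <-trans (Holds-< h′) S<W

  -- Each pass overwrites exactly the pair it has just read, so the unread pairs above and the table
  -- below stay intact.
  loop-run : ∀ ps {a p x scr} {μ : Memory S} → p ≤ n → x ≤ M →
             All (λ (u , v) → u ≤ n × v ≤ M) ps → PairsFrom μ a (map (enc b N M) ps) →
             Table μ → tb + n < a → Bounded W μ → end ≡ length ps * 2 + a → Looped a p x ps scr μ
  loop-run [] p≤n x≤M _ _ _ _ bounded refl = record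
    { exec = while-false (<-irrefl refl) ; time≤ = ≤-refl ; p′≤n = p≤n ; x′≤M = x≤M
    ; output = refl ; length≡ = refl ; stored = tt ; below = λ _ h → h ; bounded = bounded }
  loop-run ((u , y) ∷ ps) {a} {p} {x} {scr} {μ} p≤n x≤M ((u≤n , y≤M) ∷ ps≤) (h , h′ , hs) table tb< bounded end≡
    with body-run {scr = scr} p≤n x≤M u≤n y≤M table h h′
  ... | run {μ′ = μ₁} exec time≤ ((scr₁ , refl) , refl) = record
    { exec = while-true a<end exec IH.exec
    ; time≤ = s≤s (≤-trans (+-mono-≤ time≤ IH.time≤)
                (≤-reflexive (+-suc (cost (body b)) (length ps * suc (cost (body b))))))
    ; p′≤n = IH.p′≤n ; x′≤M = IH.x′≤M
    ; output = cong (outPair (g p) x u y ∷_) IH.output ; length≡ = cong suc IH.length≡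
    ; stored = IH.below (s≤s (n≤1+n a)) (proj₁ here₂) , IH.below ≤-refl (proj₂ here₂) , IH.stored
    ; below = λ c<a → IH.below (m≤n⇒m≤o+n 2 c<a) ∘ below₁ c<a
    ; bounded = IH.bounded }
    where
    a<end : a < end
    a<end = subst (a <_) (sym end≡) (s≤s (m≤n⇒m≤1+n (m≤n+m a _)))
    p₀≡ = proj₁ (proj₂ h)
    p₁≡ = proj₁ (proj₂ h′)
    cd = enc b N (suc M) (outPair (g p) x u y)
    here₂ = writePair-here μ p₀≡ p₁≡ cd
    below₁ : ∀ {c v} → c < a → Holds μ c v → Holds μ₁ c v
    below₁ = writePair-below μ p₀≡ p₁≡ cd
    cd<W = let ou≤ , ov≤ = outPair-≤ {g p} {x} {u} {y} u≤n (g≤N p≤n) x≤M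
           in enc-< b N<W M<W ou≤ (m≤n⇒m≤1+n ov≤)
    IH = loop-run ps {scr = scr₁} u≤n (carry-≤ {g p} {x} {u} {y} x≤M y≤M) ps≤
           (PairsFrom-resp (map (enc b N M) ps) (λ 2+a≤c _ → writePair-above μ p₀≡ p₁≡ cd 2+a≤c) hs)
           (λ p≤n → below₁ (≤-<-trans (+-monoʳ-≤ tb p≤n) tb<) (table p≤n))
           (m≤n⇒m≤o+n 2 tb<)
           (writePair-Bounded μ p₀≡ p₁≡ cd (proj₁ cd<W) (proj₂ cd<W) bounded)
           (trans end≡ (sym (trans (+-suc _ (suc a)) (cong suc (+-suc _ a)))))
    module IH = Looped IH

setup-run : ∀ {W S} {μ : Memory S} s {L base N M} →
            Holds μ 0 L → Holds μ 1 base → Holds μ 2 N → (h : Holds μ 3 M) →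
            4 < W → L * 2 + base < W → suc M < W → 4 + s * N < W →
            Run W setup (s ∷ Vec.replicate 16 0) μ λ ρ′ μ′ →
              (∃[ scr ] ρ′ ≡ state s base (L * 2 + base) 0 M N M (4 + s * N) scr) ×
              μ′ ≡ write μ (proj₁ h) (suc M)
setup-run s {L} {base} count start width height 4<W end<W M<W tb<W =
  set! (≤-trans (m≤n+m 2 3) 4<W) (set! (≤-trans (m≤n+m 3 2) 4<W) (load! width
  (load! count (arith! (≤-<-trans (m≤m+n (L * 2) base) end<W) (load! start (arith! end<W
  (arith! (≤-trans (m≤n+m 4 1) 4<W) (load! height (arith! M<W
  (store! (proj₁ height) (proj₁ (proj₂ height))
  (arith! (<⇒≤ M<W)
  (arith! (≤-trans (m≤n+m (suc (s * _)) 4) tb<W) (arith! 4<W (arith! tb<W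
  (skip! ((_ , refl) , refl))))))))))))))))

module _ {W S : ℕ} (b : Bool) (n M s tb end : ℕ) (g : ℕ → ℕ)
         (N<W : suc n < W) (M<W : suc M < W) (S<W : S < W)
         (g≤N : ∀ {p} → p ≤ n → g p ≤ suc n) where

  private
    N  = suc n
    st = λ ptr p x → state s ptr end p x N M tb

  Finished : ℕ → List (ℕ × ℕ) → Memory S → Memory S → Set
  Finished L ps μ μ′ =
    Holds μ′ 0 (length ps + L) × PairsFrom μ′ end (map (enc b N (suc M)) ps) ×
    (∀ {c v} → c ≢ 0 → c < end → Holds μ c v → Holds μ′ c v) × Bounded W μ′

  -- The space bound is phrased with the same `bumpSparse` call as the result, so it asks for room
  -- for a pair only when one is written.
  finish-run : ∀ {L p x scr} {μ : Memory S} → p ≤ n → x ≤ M → Holds μ 0 L → Table b n M s tb end g N<W M<W S<W g≤N μ →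
               0 < end → Bounded W μ → L ≤ n →
               length (bumpSparse g N p x []) * 2 + end ≤ S →
               Run W (finish b) (st end p x scr) μ (λ _ μ′ → Finished L (bumpSparse g N p x []) μ μ′)
  finish-run {L} {p} {x} {_ ∷ _ ∷ _ ∷ _ ∷ _ ∷ _ ∷ []} {μ} p≤n x≤M count table 0<end bounded L≤n space
    with g p <? N
  ... | no g≮N rewrite dec-false (g p <? N) g≮N =
    arith! (<-trans (Holds-< (table p≤n)) S<W) (load! (table p≤n)
      (if-false! g≮N (skip! (count , tt , (λ _ _ h → h) , bounded))))
  ... | yes g<N rewrite dec-true (g p <? N) g<N =
    arith! (<-trans (Holds-< (table p≤n)) S<W) (load! (table p≤n)
      (if-true! g<N (arith! (<-trans g<N N<W) (arith! (≤-<-trans x≤M (<⇒≤ M<W))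
      (seq! (put-run N<W M<W (<-trans space S<W) b {p₀ = p₀} {p₁} p₀≡ p₁≡ λ where
        (_ ∷ _ ∷ _ ∷ _ ∷ _ ∷ _ ∷ []) →
          load! count₁ (arith! 1+L<W (store! (proj₁ count) p≡0 (skip!
            ( write-here _ (proj₁ count) (suc L) p≡0
            , ( write-there _ _ _ (>⇒≢ (subst (_< end) (sym p≡0) 0<end)) (proj₁ here₂)
              , write-there _ _ _ (>⇒≢ (subst (_< suc end) (sym p≡0) (m<n⇒m<1+n 0<end))) (proj₂ here₂)
              , tt)
            , (λ c≢0 c<end h → write-there _ _ _ (λ eq → c≢0 (trans eq p≡0)) (writePair-below μ p₀≡ p₁≡ cd c<end h))
            , write-Bounded _ (proj₁ count) _ 1+L<W (writePair-Bounded μ p₀≡ p₁≡ cd (proj₁ cd<W) (proj₂ cd<W) bounded)))))))))))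
    where
    p₀ p₁ : Fin S
    p₀ = fromℕ< (<⇒≤ space)
    p₁ = fromℕ< space
    p₀≡ = toℕ-fromℕ< (<⇒≤ space)
    p₁≡ = toℕ-fromℕ< space
    cd = enc b N (suc M) (g p , x)
    p≡0 = proj₁ (proj₂ count)
    here₂ = writePair-here μ p₀≡ p₁≡ cd
    count₁ = writePair-below μ p₀≡ p₁≡ cd 0<end count
    cd<W = enc-< b N<W M<W (<⇒≤ g<N) (m≤n⇒m≤1+n x≤M)
    1+L<W : suc L < W
    1+L<W = ≤-<-trans (s≤s L≤n) N<W

-- Memory layout and a complete update

listStart : ℕ → ℕ → ℕ
listStart k n = 4 + k * suc n

-- Cells 0 and 1 form the header prescribed by `StoresList`, and cells 2 and 3 hold the parameters
-- of `enc`. Then come `k` table rows, one per letter of the alphabet, and finally the pairs.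
record Stored {k S} (b : Bool) (cs : Str k) (m : ℕ) (ys : List ℕ) (W : ℕ) (μ : Memory S) : Set where
  field
    count   : Holds μ 0 (length (sparse 0 ys))
    start   : Holds μ 1 (listStart k (length cs))
    width   : Holds μ 2 (suc (length cs))
    height  : Holds μ 3 (suc m)
    table   : ∀ σ {p} → p ≤ length cs → Holds μ (4 + toℕ σ * suc (length cs) + p) (nextIn cs σ p)
    entries : PairsFrom μ (listStart k (length cs)) (pairs b (length cs) m ys)
    bounded : Bounded W μ

-- Here `c`, `d` and `e` are the costs of setup, finish and loop body; the factor `suc L` is
-- positive, so it covers the fixed costs even for `L = 0`.
linear-time : ∀ c d e L → c + (suc (L * suc e) + d) ≤ (suc (c + d) + suc e) * suc L
linear-time c d e L = begin
  c + (suc (L * suc e) + d)                ≡⟨ cong (c +_) (+-comm (suc (L * suc e)) d) ⟩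
  c + (d + suc (L * suc e))                ≡⟨ +-assoc c d _ ⟨
  c + d + suc (L * suc e)                  ≡⟨ +-suc (c + d) _ ⟩
  suc (c + d) + L * suc e                  ≤⟨ +-mono-≤ (m≤m*n _ (suc L)) (*-monoˡ-≤ (suc e) (n≤1+n L)) ⟩
  suc (c + d) * suc L + suc L * suc e      ≡⟨ cong (suc (c + d) * suc L +_) (*-comm (suc L) (suc e)) ⟩
  suc (c + d) * suc L + suc e * suc L      ≡⟨ *-distribʳ-+ (suc L) (suc (c + d)) (suc e) ⟨
  (suc (c + d) + suc e) * suc L            ∎
  where open ≤-Reasoning

timeBound : Bool → ℕ
timeBound b = suc (cost setup + cost (finish b)) + suc (cost (body b))

module _ {k} (cs : Str k) where

  private
    n = length cs
    base = listStart k n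

  -- The factor `6 + k` splits into 2 for the pairs, 4 for the header and `k` for the table.
  listEnd≤S : ∀ {S l} → (6 + k) * suc n ≤ S → l ≤ n → l * 2 + base ≤ S
  listEnd≤S {l = l} space l≤n = ≤-trans (begin
    l * 2 + (4 + k * suc n)              ≤⟨ +-monoˡ-≤ base (*-monoˡ-≤ 2 (m≤n⇒m≤1+n l≤n)) ⟩
    suc n * 2 + (4 + k * suc n)          ≤⟨ +-monoʳ-≤ (suc n * 2) (+-monoˡ-≤ (k * suc n) (*-monoʳ-≤ 4 (s≤s z≤n))) ⟩
    suc n * 2 + (4 * suc n + k * suc n)  ≡⟨ +-assoc (suc n * 2) _ _ ⟨
    suc n * 2 + 4 * suc n + k * suc n    ≡⟨ cong (λ z → z + 4 * suc n + k * suc n) (*-comm (suc n) 2) ⟩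
    2 * suc n + 4 * suc n + k * suc n    ≡⟨ cong (_+ k * suc n) (*-distribʳ-+ (suc n) 2 4) ⟨
    6 * suc n + k * suc n                ≡⟨ *-distribʳ-+ (suc n) 6 k ⟨
    (6 + k) * suc n                      ∎) space
    where open ≤-Reasoning

  tableRow<base : ∀ (σ : Fin k) → 4 + toℕ σ * suc n + n < base
  tableRow<base σ = +-monoʳ-≤ 4 (begin
    suc (toℕ σ * suc n + n) ≡⟨ +-suc _ n ⟨
    toℕ σ * suc n + suc n   ≡⟨ +-comm _ (suc n) ⟩
    suc (toℕ σ) * suc n     ≤⟨ *-monoˡ-≤ (suc n) (toℕ<n σ) ⟩
    k * suc n               ∎)
    where open ≤-Reasoning

module _ {k S W W₀ : ℕ} (b : Bool) (cs : Str k) {m : ℕ} {ys : List ℕ}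
         (W₀≤W : W₀ ≤ W) (S<W : S < W) (m+2<W : 2 + m < W) (space : (6 + k) * suc (length cs) ≤ S)
         (length-ys : length ys ≡ length cs) (ys≤m : All (_≤ m) ys) where

  private
    n = length cs
    N = suc n
    M = suc m
    base = listStart k n

  -- `W₀` and `W` are the word bounds before and after the update; the program runs under the
  -- latter.
  update-run : ∀ {μ : Memory S} → Stored b cs m ys W₀ μ → ∀ σ →
    ∃[ t ] ∃[ ρ′ ] ∃[ μ′ ] Exec W (update b) (toℕ σ ∷ Vec.replicate 16 0) μ t ρ′ μ′ ×
      t ≤ timeBound b * suc (length (sparse 0 ys)) ×
      Stored b cs (suc m) (bump σ (suc m) cs ys) W μ′
  update-run {μ} stored σ =
    ₁.time + (₂.time + ₃.time) , ₃.ρ′ , ₃.μ′ , seq exec₁ (seq ₂.exec ₃.exec) , time≤ , stored′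
    where
    open Stored stored
    L = length (sparse 0 ys)
    s = toℕ σ
    tb = 4 + s * N
    end = L * 2 + base
    g = nextIn cs σ
    L≤n : L ≤ n
    L≤n = subst (L ≤_) length-ys (length-sparse 0 ys)
    N<W : N < W
    N<W = ≤-<-trans (≤-trans (m≤n*m N (6 + k)) space) S<W
    base<W : base < W
    base<W = ≤-<-trans (listEnd≤S cs space z≤n) S<W
    μ₁ = write μ (proj₁ height) (suc M)
    keep₁ : ∀ {c v} → c ≢ 3 → Holds μ c v → Holds μ₁ c v
    keep₁ c≢3 = write-there μ (proj₁ height) (suc M) (λ eq → c≢3 (trans eq (proj₁ (proj₂ height))))
    bounded₁ : Bounded W μ₁
    bounded₁ = write-Bounded μ (proj₁ height) (suc M) m+2<W (λ p → <-≤-trans (bounded p) W₀≤W)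
    g≤N : ∀ {p} → p ≤ n → g p ≤ suc n
    g≤N = nextIn-≤ cs σ
    setUp = setup-run {W} s count start width height (≤-<-trans (m≤m+n 4 (k * N)) base<W)
              (≤-<-trans (listEnd≤S cs space L≤n) S<W) m+2<W
              (<-trans (≤-<-trans (m≤m+n tb n) (tableRow<base cs σ)) base<W)
    module ₁ = Run setUp
    looped = loop-run b n M s tb end g N<W m+2<W S<W g≤N (sparse 0 ys) {scr = proj₁ (proj₁ ₁.post)} z≤n ≤-refl
               (All.map (λ (_ , u≤n , v≤m) → subst (_ ≤_) length-ys u≤n , m≤n⇒m≤1+n v≤m) (sparse-bounds 0 ys ys≤m))
               (PairsFrom-resp (pairs b n m ys) (λ base≤c _ → keep₁ (>⇒≢ (<-≤-trans (m≤m+n 4 (k * N)) base≤c))) entries)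
               (λ p≤n → keep₁ (λ ()) (table σ p≤n)) (tableRow<base cs σ) bounded₁ refl
    module ₂ = Looped looped
    tail = bumpSparse g N ₂.p′ ₂.x′ []
    new≡ : sparse 0 (bump σ M cs ys) ≡ ₂.qs ++ tail
    new≡ = trans (sparse-bump σ 0 m cs ys length-ys (nextIn-IsNext σ cs 0 cs refl) refl) ₂.output
    length-new : length (sparse 0 (bump σ M cs ys)) ≡ length tail + L
    length-new = trans (cong length new≡) (trans (length-++ ₂.qs)
                   (trans (+-comm (length ₂.qs) _) (cong (length tail +_) ₂.length≡)))
    -- The updated list is again a sparse list over `n` rows, so the appended pair still fits in
    -- memory.
    length-new≤n : length tail + L ≤ n
    length-new≤n = subst₂ _≤_ length-new (bump-length σ M cs length-ys) (length-sparse 0 (bump σ M cs ys))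
    finished = finish-run b n M s tb end g N<W m+2<W S<W g≤N {scr = ₂.scr′} ₂.p′≤n ₂.x′≤M
                 (₂.below (s≤s z≤n) (keep₁ (λ ()) count))
                 (λ p≤n → ₂.below (≤-<-trans (+-monoʳ-≤ tb p≤n) (tableRow<base cs σ)) (keep₁ (λ ()) (table σ p≤n)))
                 (<-≤-trans (s≤s z≤n) (m≤n+m base (L * 2))) ₂.bounded L≤n
                 (subst (_≤ S) (trans (cong (_+ base) (*-distribʳ-+ 2 (length tail) L)) (+-assoc (length tail * 2) _ base))
                   (listEnd≤S cs space length-new≤n))
    module ₃ = Run finished
    count₃ = proj₁ ₃.post
    tail₃ = proj₁ (proj₂ ₃.post)
    below₃ : ∀ {c v} → c ≢ 0 → c < end → Holds ₂.μ′ c v → Holds ₃.μ′ c v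
    below₃ = proj₁ (proj₂ (proj₂ ₃.post))
    bounded₃ = proj₂ (proj₂ (proj₂ ₃.post))
    keep : ∀ {c v} → c ≢ 0 → c < base → Holds μ₁ c v → Holds ₃.μ′ c v
    keep c≢0 c<base h = below₃ c≢0 (<-≤-trans c<base (m≤n+m base (L * 2))) (₂.below c<base h)
    length-qs : length (map (enc b N (suc M)) ₂.qs) * 2 + base ≡ end
    length-qs = cong (λ l → l * 2 + base) (trans (length-map _ ₂.qs) ₂.length≡)
    stored′ : Stored b cs (suc m) (bump σ (suc m) cs ys) W ₃.μ′
    stored′ = record
      { count = subst (Holds ₃.μ′ 0) (sym length-new) count₃
      ; start = keep (λ ()) (s≤s (s≤s z≤n)) (keep₁ (λ ()) start)
      ; width = keep (λ ()) (s≤s (s≤s (s≤s z≤n))) (keep₁ (λ ()) width)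
      ; height = keep (λ ()) (s≤s (s≤s (s≤s (s≤s z≤n)))) (write-here μ (proj₁ height) (suc M) (proj₁ (proj₂ height)))
      ; table = λ τ p≤n → keep (λ ()) (≤-<-trans (+-monoʳ-≤ (4 + toℕ τ * N) p≤n) (tableRow<base cs τ)) (keep₁ (λ ()) (table τ p≤n))
      ; entries = subst (PairsFrom ₃.μ′ base) (sym (trans (cong (map (enc b N (suc M))) new≡) (map-++ _ ₂.qs tail)))
          (PairsFrom-++ (map (enc b N (suc M)) ₂.qs)
            (PairsFrom-resp (map (enc b N (suc M)) ₂.qs)
              (λ {c} base≤c c<end → below₃ (>⇒≢ (<-≤-trans (s≤s z≤n) base≤c)) (subst (c <_) length-qs c<end)) ₂.stored)
            (subst (λ a → PairsFrom ₃.μ′ a (map (enc b N (suc M)) tail)) (sym length-qs) tail₃))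
      ; bounded = bounded₃ }
    time≤ : ₁.time + (₂.time + ₃.time) ≤ timeBound b * suc L
    time≤ = ≤-trans (+-mono-≤ ₁.time≤ (+-mono-≤ ₂.time≤ ₃.time≤))
      (linear-time (cost setup) (cost (finish b)) (cost (body b)) L)
    exec₁ : Exec W setup (s ∷ Vec.replicate 16 0) μ ₁.time (state s base end 0 M N M tb (proj₁ (proj₁ ₁.post))) μ₁
    exec₁ = subst₂ (Exec W setup (s ∷ Vec.replicate 16 0) μ ₁.time) (proj₂ (proj₁ ₁.post)) (proj₂ ₁.post) ₁.exec

-- The initial memory

sparse-zeros : ∀ p n → sparse p (replicate n 0) ≡ []
sparse-zeros p zero    = refl
sparse-zeros p (suc n) = sparse-zeros (suc p) n

module _ {k} (cs : Str k) where

  private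
    N = suc (length cs)

  tableCell : Fin k × Fin N → ℕ
  tableCell (σ , p) = nextIn cs σ (toℕ p)

  initialCell : ℕ → ℕ
  initialCell 0 = 0
  initialCell 1 = listStart k (length cs)
  initialCell 2 = N
  -- The height `length H + 1` for empty `H`.
  initialCell 3 = 1
  initialCell (suc (suc (suc (suc a)))) with a <? k * N
  ... | yes a<kN = tableCell (remQuot N (fromℕ< a<kN))
  ... | no  _    = 0

  -- The offset `toℕ σ * N + p` is that of `combine σ p`, which `remQuot` inverts.
  initialCell-table : ∀ σ {p} → p ≤ length cs → initialCell (4 + toℕ σ * N + p) ≡ nextIn cs σ p
  initialCell-table σ {p} p≤n with toℕ σ * N + p <? k * N
  ... | no a≮kN = contradiction
    (subst (_< k * N) (trans (toℕ-combine σ p′) (cong₂ _+_ (*-comm N (toℕ σ)) p≡)) (toℕ<n (combine σ p′))) a≮kN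
    where
    p′ = fromℕ< (s≤s p≤n)
    p≡ = toℕ-fromℕ< (s≤s p≤n)
  ... | yes a<kN = trans (cong (tableCell ∘ remQuot N) a≡)
                     (trans (cong tableCell (remQuot-combine σ p′)) (cong (nextIn cs σ) p≡))
    where
    p′ = fromℕ< (s≤s p≤n)
    p≡ = toℕ-fromℕ< (s≤s p≤n)
    a≡ : fromℕ< a<kN ≡ combine σ p′
    a≡ = toℕ-injective (trans (toℕ-fromℕ< a<kN)
           (sym (trans (toℕ-combine σ p′) (cong₂ _+_ (*-comm N (toℕ σ)) p≡))))

  initialCell-< : ∀ {W} → listStart k (length cs) < W → N < W → ∀ a → initialCell a < W
  initialCell-< base<W N<W 0 = ≤-<-trans z≤n N<W
  initialCell-< base<W N<W 1 = base<W
  initialCell-< base<W N<W 2 = N<W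
  initialCell-< base<W N<W 3 = ≤-<-trans (s≤s z≤n) N<W
  initialCell-< base<W N<W (suc (suc (suc (suc a)))) with a <? k * N
  ... | yes a<kN = let σ , p = remQuot {k} N (fromℕ< a<kN) in ≤-<-trans (nextIn-≤ cs σ (toℕ≤pred[n] p)) N<W
  ... | no  _    = ≤-<-trans z≤n N<W

  initial-Stored : ∀ {S W} b → (6 + k) * N ≤ S → S < W →
                   Stored {S = S} b cs 0 (replicate (length cs) 0) W (initialCell ∘ toℕ)
  initial-Stored {S} {W} b space S<W = record
    { count   = subst (Holds _ 0) (sym (cong length no-pivots)) (cell 0<base refl)
    ; start   = cell (s≤s (s≤s z≤n)) refl
    ; width   = cell (s≤s (s≤s (s≤s z≤n))) refl
    ; height  = cell (s≤s (s≤s (s≤s (s≤s z≤n)))) refl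
    ; table   = λ σ p≤n → cell (≤-<-trans (+-monoʳ-≤ (4 + toℕ σ * N) p≤n) (tableRow<base cs σ)) (initialCell-table σ p≤n)
    ; entries = subst (λ ps → PairsFrom {S} (initialCell ∘ toℕ) base (map (enc b N 1) ps)) (sym no-pivots) tt
    ; bounded = λ p → initialCell-< (≤-<-trans base≤S S<W) (≤-<-trans (≤-trans (m≤n*m N (6 + k)) space) S<W) (toℕ p)
    }
    where
    base = listStart k (length cs)
    no-pivots = sparse-zeros 0 (length cs)
    0<base : 0 < base
    0<base = s≤s z≤n
    base≤S : base ≤ S
    base≤S = listEnd≤S cs {l = 0} space z≤n
    cell : ∀ {a v} → a < base → initialCell a ≡ v → Holds {S} (initialCell ∘ toℕ) a v
    cell a<base eq = fromℕ< a<S , toℕ-fromℕ< a<S , trans (cong initialCell (toℕ-fromℕ< a<S)) eq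
      where a<S = <-≤-trans a<base base≤S

-- The invariant kept between updates

record Represented {k S} (b : Bool) (cs H : Str k) (W : ℕ) (μ : Memory S) : Set where
  field
    ys     : List ℕ
    fits   : Fits H [] cs ys
    len    : length ys ≡ length cs
    ys≤m   : All (_≤ length H) ys
    stored : Stored b cs (length H) ys W μ

module _ {k S} (b : Bool) {cs : Str k} (space : (6 + k) * suc (length cs) ≤ S) where

  Represented-initial : ∀ {W} → S < W → Represented {S = S} b cs [] W (initialCell cs ∘ toℕ)
  Represented-initial S<W = record
    { ys = replicate (length cs) 0 ; fits = Fits-[] [] cs ; len = length-replicate (length cs)
    ; ys≤m = Allₚ.replicate⁺ (length cs) z≤n ; stored = initial-Stored cs b space S<W }

  Represented-update : ∀ {H W W₀} {μ : Memory S} → W₀ ≤ W → S < W → 2 + length H < W →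
    Represented b cs H W₀ μ → ∀ σ → ∃[ t ] ∃[ ρ′ ] ∃[ μ′ ]
      Exec W (update b) (toℕ σ ∷ Vec.replicate 16 0) μ t ρ′ μ′ ×
      t ≤ timeBound b * suc (lcs (reverse cs) H) × Represented b cs (σ ∷ H) W μ′
  Represented-update {H} W₀≤W S<W m+2<W rep σ =
    let t , ρ′ , μ′ , exec , t≤ , stored′ = update-run b cs W₀≤W S<W m+2<W space len ys≤m stored σ
    in t , ρ′ , μ′ , exec , ≤-trans t≤ (*-monoʳ-≤ (timeBound b) (s≤s (≤-reflexive length≡))) , record
      { ys = bump σ (suc (length H)) cs ys
      ; fits = Fits-bump σ H fits ys≤M ≤-refl (Carries-initial σ H)
      ; len = bump-length σ _ cs len
      ; ys≤m = bump-≤ σ cs ≤-refl ys≤M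
      ; stored = stored′ }
    where
    open Represented rep
    ys≤M = All.map m≤n⇒m≤1+n ys≤m
    length≡ : length (sparse 0 ys) ≡ lcs (reverse cs) H
    -- At `v = 0` nothing is cut from `H`, so the pivots count the LCS of the full strings.
    length≡ = trans (sym (Fits-total 0 fits)) (cong (lcs (reverse cs)) (take-all (length H) H ≤-refl))

  Represented-StoresList : ∀ {H W} {μ : Memory S} (rep : Represented b cs H W μ) →
                           StoresList μ (pairs b (length cs) (length H) (Represented.ys rep))
  Represented-StoresList {μ = μ} rep =
    subst (Holds μ 0) (sym (length-map _ (sparse 0 ys))) count , _ , start , entries
    where
    open Represented rep
    open Stored stored

-- Word size

n<2^n : ∀ n → n < 2 ^ n
n<2^n zero    = s≤s z≤n
n<2^n (suc n) = +-mono-≤ (m^n>0 2 n) (≤-trans (n<2^n n) (m≤m+n (2 ^ n) 0))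

-- The constant is absorbed into the exponent: `c < 2 ^ c ≤ (2 + b) ^ c`, and one further factor
-- `2 + b` exceeds `a`.
word-size : ∀ {c e a b} → c < e → a < 2 + b → c * a < (2 + b) ^ e
word-size {c} {e} {a} {b} c<e a<2+b = begin-strict
  c * a                ≡⟨ *-comm c a ⟩
  a * c                ≤⟨ *-monoʳ-≤ a (<⇒≤ c<) ⟩
  a * (2 + b) ^ c      <⟨ *-monoˡ-< ((2 + b) ^ c) {{>-nonZero (≤-<-trans z≤n c<)}} a<2+b ⟩
  (2 + b) ^ suc c      ≤⟨ ^-monoʳ-≤ (2 + b) c<e ⟩
  (2 + b) ^ e          ∎
  where
  open ≤-Reasoning
  c< : c < (2 + b) ^ c
  c< = <-≤-trans (n<2^n c) (^-monoˡ-≤ c (m≤m+n 2 b))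

word-length : ∀ {e a b} → 1 < e → a < 2 + b → a < (2 + b) ^ e
word-length 1<e a<2+b = ≤-<-trans (≤-reflexive (sym (*-identityˡ _))) (word-size 1<e a<2+b)

-- The two data structures

prepending : ∀ k → DataStructure k (λ B A → A) (λ B A → B) (λ σ A → σ ∷ A)
prepending k = record
  -- The exponent exceeds the space constant by one, as `word-size` requires, so every address fits
  -- in a word.
  { spaceC = 6 + k ; timeC = timeBound true ; wordC = k + 7
  ; extraRegisters = 16 ; update = update true
  ; Represents = Represents
  ; initial = initial
  ; words = λ rep → Stored.bounded (Represented.stored rep)
  ; encodes = λ {B} {A} → encodes B A
  ; update-correct = λ {B} {A} → step B A
  }
  where
  W : Str k → Str k → ℕ
  W B A = (2 + length A + length B) ^ (k + 7)
  Represents : (B A : Str k) → Memory ((6 + k) * suc (length B)) → Set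
  -- `B` is fixed and scanned from its end; `A` plays the part of `H`.
  Represents B A = Represented true (reverse B) A (W B A)
  space : ∀ B → (6 + k) * suc (length (reverse B)) ≤ (6 + k) * suc (length B)
  space B = ≤-reflexive (cong (λ n → (6 + k) * suc n) (length-reverse B))
  S<W : ∀ B A → (6 + k) * suc (length B) < W B A
  S<W B A = word-size {6 + k} {k + 7} (≤-reflexive (+-comm 7 k)) (s≤s (s≤s (m≤n+m (length B) (length A))))
  step : ∀ B A {μ} → Represents B A μ → ∀ σ →
    ∃[ t ] ∃[ ρ′ ] ∃[ μ′ ] Exec (W B (σ ∷ A)) (update true) (toℕ σ ∷ Vec.replicate 16 0) μ t ρ′ μ′ ×
      t ≤ timeBound true * suc (lcs A B) × Represents B (σ ∷ A) μ′
  step B A rep σ =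
    let t , ρ′ , μ′ , exec , t≤ , rep′ = Represented-update true (space B)
          (^-monoˡ-≤ (k + 7) (n≤1+n _)) (S<W B (σ ∷ A)) (word-length (≤-trans (m≤n+m 2 5) (m≤n+m 7 k)) (s≤s (s≤s (s≤s (m≤m+n (length A) (length B)))))) rep σ
    in t , ρ′ , μ′ , exec ,
       subst (λ ℓ → t ≤ timeBound true * suc ℓ) (trans (cong (λ X → lcs X A) (reverse-involutive B)) (lcs-comm B A)) t≤ ,
       rep′
  -- The structure for `A` is obtained from the one for the empty string by running the updates
  -- themselves.
  initial : ∀ B A → ∃[ μ ] Represents B A μ
  initial B []      = _ , Represented-initial true (space B) (S<W B [])
  initial B (σ ∷ A) = let _ , _ , μ′ , _ , _ , rep = step B A (proj₂ (initial B A)) σ in μ′ , rep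
  encodes : ∀ B A {μ} → Represents B A μ → Encodes𝒥 A B μ
  encodes B A {μ} rep = pairs true (length B) (length A) ys ,
    subst (λ n → StoresList μ (pairs true n (length A) ys)) (length-reverse B) (Represented-StoresList true (space B) rep) ,
    enc-Unique true (suc (length B)) ys (≤-trans (≤-reflexive len′) (n≤1+n _)) ys≤m ,
    pairs-suffix A B fits len′ ys≤m
    where
    open Represented rep
    len′ : length ys ≡ length B
    len′ = trans len (length-reverse B)

appending : ∀ k → DataStructure k (λ A B → A) (λ A B → B) (λ σ B → B ∷ʳ σ)
appending k = record
  { spaceC = 6 + k ; timeC = timeBound false ; wordC = k + 7
  ; extraRegisters = 16 ; update = update false
  ; Represents = Represents
  ; initial = λ A B → initial A (reverseView B)
  ; words = λ rep → Stored.bounded (Represented.stored rep)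
  ; encodes = λ {A} {B} → encodes A B
  ; update-correct = λ {A} {B} → step A B
  }
  where
  W : Str k → Str k → ℕ
  W A B = (2 + length A + length B) ^ (k + 7)
  Represents : (A B : Str k) → Memory ((6 + k) * suc (length A)) → Set
  -- `A` is scanned from its start and `reverse B` plays the part of `H`, so appending to `B` is a
  -- cons.
  Represents A B = Represented false A (reverse B) (W A B)
  S<W : ∀ A B → (6 + k) * suc (length A) < W A B
  S<W A B = word-size {6 + k} {k + 7} (≤-reflexive (+-comm 7 k)) (s≤s (s≤s (m≤m+n (length A) (length B))))
  length-snoc : ∀ (B : Str k) σ → length (B ∷ʳ σ) ≡ suc (length B)
  length-snoc B σ = trans (length-++ B) (+-comm (length B) 1)
  step : ∀ A B {μ} → Represents A B μ → ∀ σ →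
    ∃[ t ] ∃[ ρ′ ] ∃[ μ′ ] Exec (W A (B ∷ʳ σ)) (update false) (toℕ σ ∷ Vec.replicate 16 0) μ t ρ′ μ′ ×
      t ≤ timeBound false * suc (lcs A B) × Represents A (B ∷ʳ σ) μ′
  step A B rep σ =
    let t , ρ′ , μ′ , exec , t≤ , rep′ = Represented-update false ≤-refl
          (^-monoˡ-≤ (k + 7) (+-monoʳ-≤ (2 + length A) (≤-trans (n≤1+n _) (≤-reflexive (sym (length-snoc B σ))))))
          (S<W A (B ∷ʳ σ)) height<W rep σ
    in t , ρ′ , μ′ , exec ,
       subst (λ ℓ → t ≤ timeBound false * suc ℓ) (lcs-reverse A B) t≤ ,
       subst (λ H → Represented false A H (W A (B ∷ʳ σ)) μ′) (sym (reverse-++ B (σ ∷ []))) rep′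
    where
    height<W : 2 + length (reverse B) < W A (B ∷ʳ σ)
    height<W = word-length (≤-trans (m≤n+m 2 5) (m≤n+m 7 k)) (s≤s (s≤s (begin
      suc (length (reverse B))    ≡⟨ cong suc (length-reverse B) ⟩
      suc (length B)              ≡⟨ length-snoc B σ ⟨
      length (B ∷ʳ σ)             ≤⟨ m≤n+m _ (length A) ⟩
      length A + length (B ∷ʳ σ)  ∎)))
      where open ≤-Reasoning
  -- Updates extend `B` at its end, hence the induction over the snoc view.
  initial : ∀ A {B} → Reverse B → ∃[ μ ] Represents A B μ
  initial A []           = _ , Represented-initial false ≤-refl (S<W A [])
  initial A (B ∶ rev ∶ʳ σ) = let _ , _ , μ′ , _ , _ , rep = step A B (proj₂ (initial A rev)) σ in μ′ , rep
  encodes : ∀ A B {μ} → Represents A B μ → Encodes𝒥 A B μ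
  encodes A B {μ} rep = pairs false (length A) (length B) ys ,
    subst (λ m → StoresList μ (pairs false (length A) m ys)) (length-reverse B) (Represented-StoresList false ≤-refl rep) ,
    enc-Unique false (suc (length A)) {suc (length B)} ys (≤-trans (≤-reflexive len) (n≤1+n _)) ys≤m ,
    pairs-prefix A B fits len (subst (λ m → All (_≤ m) ys) (length-reverse B) ys≤m)
    where
    open Represented rep

theorem4p7 : (k : ℕ) →
    DataStructure k (λ B A → A) (λ B A → B) (λ σ A → σ ∷ A) ×
    DataStructure k (λ A B → A) (λ A B → B) (λ σ B → B ∷ʳ σ)
theorem4p7 k = prepending k , appending k
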